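{- Let $n\ge 2$ be an integer and let $x,y$ be complex numbers such that no denominator below vanishes, i.e. $x\notin\{ -1,\dots,-n\}$, $x-y\notin\{ -1,\dots,-n\}$, $1+x-y+ny\ne0$ and $y\notin\{ -n,-n+1,\dots,n-1\}$. Then $$\sum_{k=0}^n(-1)^k\binom{n}{k}\frac{\binom{y+k}{k}}{\binom{y-n+k}{k}}\frac{(y-1)y}{(y+k-1)(y+k)}H_{k}^{\langle2\rangle}(x)$$ $$=\frac{(-1)^n(1+x-y+ny)}{n(n-1)(1+x-y)}\,\frac{\binom{x-y+n}{n}}{\binom{x+n}{n}\binom{y}{n}}\bigg\{H_{n}(x)-H_{n}(x-y)+\frac{ny}{(1+x-y)(1+x-y+ny)}\bigg\}.$$
   Context: For a complex number $u$ and an integer $k\ge 0$, $\binom{u}{k}=\frac{u(u-1)\cdots(u-k+1)}{k!}$ (equal to $1$ for $k=0$). For a complex number $u$ and a positive integer $\ell$, the generalized harmonic numbers of $\ell$-order are $H_0^{\langle\ell\rangle}(u)=0$ and $H_n^{\langle\ell\rangle}(u)=\sum_{k=1}^n\frac{1}{(u+k)^\ell}$ for $n\ge1$; $H_n(u)=H_n^{\langle1\rangle}(u)$. -}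

module Defs where

open import Algebra.Apartness.Bundles using (HeytingCommutativeRing; HeytingField)
open import Algebra.Apartness.Structures using (IsHeytingField)
open import Algebra.Bundles using (CommutativeRing)
open import Algebra.Definitions using (Invertible)
open import Algebra.Structures using (IsCommutativeRing)
import Algebra.Apartness.Properties.HeytingCommutativeRing as HeytingProperties
open import Data.Empty using (⊥; ⊥-elim)
open import Data.Fin.Base using (toℕ)
open import Data.Fin.Properties using (toℕ<n)
open import Data.Integer.Base as ℤ using (ℤ)
import Data.Integer.Properties as ℤ
open import Data.Nat.Base as ℕ using (ℕ; zero; suc; _!)
import Data.Nat.Properties as ℕ
open import Data.Nat.Properties using (_!≢0)
open import Data.Product.Base using (Σ; ∃; ∃-syntax; _×_; _,_; proj₁; proj₂)
open import Data.Rational.Base as ℚ using (ℚ; 0ℚ; 1ℚ; ½)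
import Data.Rational.Base as Rat
import Data.Rational.Properties as ℚ
open import Data.Rational.Solver using (module +-*-Solver)
open import Data.Sum.Base as Sum using (_⊎_; inj₁; inj₂)
open import Level using (0ℓ)
open import Relation.Binary.PropositionalEquality as ≡
  using (_≡_; cong; cong₂; subst; subst₂)
open import Relation.Nullary using (¬_; Dec; yes; no)

module RationalEstimates where

  open Rat
  open +-*-Solver
  open ≡ using (refl; sym; trans)

  0<1 : 0ℚ < 1ℚ
  0<1 = ℚ.positive⁻¹ 1ℚ

  *-pos : ∀ {p q} → 0ℚ < p → 0ℚ < q → 0ℚ < p * q
  *-pos {p} {q} 0<p 0<q =
    ℚ.positive⁻¹ (p * q) ⦃ ℚ.pos*pos⇒pos p ⦃ positive 0<p ⦄ q ⦃ positive 0<q ⦄ ⦄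

  half-pos : ∀ {ε} → 0ℚ < ε → 0ℚ < ½ * ε
  half-pos = *-pos (ℚ.positive⁻¹ ½)

  halves : ∀ ε → ½ * ε + ½ * ε ≡ ε
  halves = solve 1 (λ ε → con ½ :* ε :+ con ½ :* ε := ε) refl

  half< : ∀ {ε} → 0ℚ < ε → ½ * ε < ε
  half< {ε} 0<ε = subst₂ _<_ (ℚ.+-identityʳ (½ * ε)) (halves ε)
    (ℚ.+-monoʳ-< (½ * ε) (half-pos 0<ε))

  sum< : ∀ {ε p q} → p < ½ * ε → q < ½ * ε → p + q < ε
  sum< {ε} p< q< = subst (_ <_) (halves ε) (ℚ.+-mono-< p< q<)

  ∣-∣-sym : ∀ p q → ∣ p - q ∣ ≡ ∣ q - p ∣
  ∣-∣-sym p q = trans (sym (ℚ.∣-p∣≡∣p∣ (p - q)))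
    (cong ∣_∣ (solve 2 (λ p q → :- (p :- q) := q :- p) refl p q))

  triangle : ∀ p q r → ∣ p - r ∣ ≤ ∣ p - q ∣ + ∣ q - r ∣
  triangle p q r = subst (λ t → ∣ t ∣ ≤ ∣ p - q ∣ + ∣ q - r ∣)
    (solve 3 (λ p q r → (p :- q) :+ (q :- r) := p :- r) refl p q r)
    (ℚ.∣p+q∣≤∣p∣+∣q∣ (p - q) (q - r))

  triangle< : ∀ {ε} p q r → ∣ p - q ∣ < ½ * ε → ∣ q - r ∣ < ½ * ε → ∣ p - r ∣ < ε
  triangle< p q r pq qr = ℚ.≤-<-trans (triangle p q r) (sum< pq qr)

  ∣p∣≤∣p-q∣+∣q∣ : ∀ p q → ∣ p ∣ ≤ ∣ p - q ∣ + ∣ q ∣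
  ∣p∣≤∣p-q∣+∣q∣ p q = subst (λ t → ∣ t ∣ ≤ ∣ p - q ∣ + ∣ q ∣)
    (solve 2 (λ p q → (p :- q) :+ q := p) refl p q)
    (ℚ.∣p+q∣≤∣p∣+∣q∣ (p - q) q)

  +-close : ∀ {ε} p q r s → ∣ p - q ∣ < ½ * ε → ∣ r - s ∣ < ½ * ε →
            ∣ (p + r) - (q + s) ∣ < ε
  +-close {ε} p q r s pq rs = ℚ.≤-<-trans
    (subst (λ t → ∣ t ∣ ≤ ∣ p - q ∣ + ∣ r - s ∣)
      (solve 4 (λ p q r s → (p :- q) :+ (r :- s) := (p :+ r) :- (q :+ s)) refl p q r s)
      (ℚ.∣p+q∣≤∣p∣+∣q∣ (p - q) (r - s)))
    (sum< pq rs)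

  *-mono-∣∣ : ∀ {A B} p q → ∣ p ∣ ≤ A → ∣ q ∣ ≤ B → ∣ p * q ∣ ≤ A * B
  *-mono-∣∣ {A} {B} p q p≤ q≤ = subst (_≤ A * B) (sym (ℚ.∣p*q∣≡∣p∣*∣q∣ p q))
    (ℚ.≤-trans
      (ℚ.*-monoˡ-≤-nonNeg ∣ p ∣ ⦃ ℚ.∣-∣-nonNeg p ⦄ q≤)
      (ℚ.*-monoʳ-≤-nonNeg B ⦃ nonNegative (ℚ.≤-trans (ℚ.0≤∣p∣ q) q≤) ⦄ p≤))

  *-mono-∣∣< : ∀ {A e} p q → 0ℚ < A → ∣ p ∣ ≤ A → ∣ q ∣ < e → ∣ p * q ∣ < A * e
  *-mono-∣∣< {A} {e} p q 0<A p≤ q< = ℚ.≤-<-trans (*-mono-∣∣ p q p≤ ℚ.≤-refl)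
    (ℚ.*-monoʳ-<-pos A ⦃ positive 0<A ⦄ q<)

  *-close : ∀ {A A⁻¹ B B⁻¹ ε} p q r s →
            0ℚ < A → A * A⁻¹ ≡ 1ℚ → 0ℚ < B → B * B⁻¹ ≡ 1ℚ →
            ∣ p ∣ ≤ A → ∣ s ∣ ≤ B → ∣ r - s ∣ < A⁻¹ * (½ * ε) → ∣ p - q ∣ < B⁻¹ * (½ * ε) →
            ∣ p * r - q * s ∣ < ε
  *-close {A} {A⁻¹} {B} {B⁻¹} {ε} p q r s 0<A AA⁻¹≡1 0<B BB⁻¹≡1 p≤ s≤ rs pq = ℚ.≤-<-trans
    (subst (λ t → ∣ t ∣ ≤ ∣ p * (r - s) ∣ + ∣ s * (p - q) ∣)
      (solve 4 (λ p q r s → p :* (r :- s) :+ s :* (p :- q) := p :* r :- q :* s) refl p q r s)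
      (ℚ.∣p+q∣≤∣p∣+∣q∣ (p * (r - s)) (s * (p - q))))
    (sum<
      (subst (∣ p * (r - s) ∣ <_) (scale A A⁻¹ AA⁻¹≡1) (*-mono-∣∣< p (r - s) 0<A p≤ rs))
      (subst (∣ s * (p - q) ∣ <_) (scale B B⁻¹ BB⁻¹≡1) (*-mono-∣∣< s (p - q) 0<B s≤ pq)))
    where
    scale : ∀ C r → C * r ≡ 1ℚ → C * (r * (½ * ε)) ≡ ½ * ε
    scale C r eq = trans (sym (ℚ.*-assoc C r (½ * ε)))
      (trans (cong (_* (½ * ε)) eq) (ℚ.*-identityˡ (½ * ε)))

  abstract
    recip : ∀ {A} → 0ℚ < A → ∃[ r ] 0ℚ < r × A * r ≡ 1ℚ
    recip {A} 0<A = (1/ A) , ℚ.positive⁻¹ (1/ A) ⦃ ℚ.1/pos⇒pos A ⦄ , ℚ.*-inverseʳ A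
      where instance
        A>0 : Positive A
        A>0 = positive 0<A
        A≠0 : NonZero A
        A≠0 = ℚ.pos⇒nonZero A

    inv : ℚ → ℚ
    inv p with p ℚ.≟ 0ℚ
    ... | yes _  = 0ℚ
    ... | no p≢0 = (1/ p) ⦃ ≢-nonZero p≢0 ⦄

    inv-inverse : ∀ {δ p} → 0ℚ < δ → δ < ∣ p ∣ → p * inv p ≡ 1ℚ
    inv-inverse {δ} {p} 0<δ δ<p with p ℚ.≟ 0ℚ
    ... | yes refl = ⊥-elim (ℚ.<-asym 0<δ δ<p)
    ... | no p≢0   = ℚ.*-inverseʳ p ⦃ ≢-nonZero p≢0 ⦄

  inv-bound : ∀ {δ r p} → 0ℚ < δ → 0ℚ < r → δ * r ≡ 1ℚ → δ < ∣ p ∣ → ∣ inv p ∣ ≤ r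
  inv-bound {δ} {r} {p} 0<δ 0<r δr≡1 δ<p = ℚ.*-cancelˡ-≤-pos δ ⦃ positive 0<δ ⦄
    (ℚ.≤-trans
      (ℚ.*-monoʳ-≤-nonNeg ∣ inv p ∣ ⦃ ℚ.∣-∣-nonNeg (inv p) ⦄ (ℚ.<⇒≤ δ<p))
      (ℚ.≤-reflexive (trans (sym (ℚ.∣p*q∣≡∣p∣*∣q∣ p (inv p)))
        (trans (cong ∣_∣ (inv-inverse 0<δ δ<p)) (sym δr≡1)))))

  reciprocals-close : ∀ {δ r ε} a b x y → 0ℚ < r → δ * r ≡ 1ℚ → a * x ≡ 1ℚ → b * y ≡ 1ℚ →
                      ∣ x ∣ ≤ r → ∣ y ∣ ≤ r → ∣ b - a ∣ < δ * δ * ε → ∣ x - y ∣ < ε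
  reciprocals-close {δ} {r} {ε} a b x y 0<r δr≡1 ax≡1 by≡1 x≤ y≤ ba =
    subst₂ (λ p q → ∣ p ∣ < q) difference scale
      (*-mono-∣∣< (x * y) (b - a) (*-pos 0<r 0<r) (*-mono-∣∣ x y x≤ y≤) ba)
    where
    difference : x * y * (b - a) ≡ x - y
    difference = trans
      (solve 4 (λ a b x y → x :* y :* (b :- a) := x :* (b :* y) :- y :* (a :* x)) refl a b x y)
      (cong₂ _-_ (trans (cong (x *_) by≡1) (ℚ.*-identityʳ x))
                 (trans (cong (y *_) ax≡1) (ℚ.*-identityʳ y)))
    scale : r * r * (δ * δ * ε) ≡ ε
    scale = trans
      (solve 3 (λ r δ ε → r :* r :* (δ :* δ :* ε) := (δ :* r) :* (δ :* r) :* ε) refl r δ ε)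
      (trans (cong₂ (λ p q → p * q * ε) δr≡1 δr≡1)
        (ℚ.*-identityˡ ε))

  square : ∀ p → p * p ≡ ∣ p ∣ * ∣ p ∣
  square p with ℚ.∣p∣≡p∨∣p∣≡-p p
  ... | inj₁ eq = sym (cong₂ _*_ eq eq)
  ... | inj₂ eq = trans (solve 1 (λ p → p :* p := (:- p) :* (:- p)) refl p) (sym (cong₂ _*_ eq eq))

  square-nonneg : ∀ p → 0ℚ ≤ p * p
  square-nonneg p = subst (_≤ p * p) (ℚ.*-zeroʳ ∣ p ∣)
    (subst (∣ p ∣ * 0ℚ ≤_) (sym (square p))
      (ℚ.*-monoˡ-≤-nonNeg ∣ p ∣ ⦃ ℚ.∣-∣-nonNeg p ⦄ (ℚ.0≤∣p∣ p)))

  square-mono : ∀ {δ p} → 0ℚ < δ → δ < ∣ p ∣ → δ * δ < p * p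
  square-mono {δ} {p} 0<δ δ<p = subst (δ * δ <_) (sym (square p))
    (ℚ.<-trans (ℚ.*-monoʳ-<-pos δ ⦃ positive 0<δ ⦄ δ<p)
      (ℚ.*-monoˡ-<-pos ∣ p ∣ ⦃ positive (ℚ.<-trans 0<δ δ<p) ⦄ δ<p))

  norm-boundˡ : ∀ {δ} p q → 0ℚ < δ → δ < ∣ p ∣ → δ * δ < ∣ p * p + q * q ∣
  norm-boundˡ {δ} p q 0<δ δ<p = ℚ.<-≤-trans (square-mono 0<δ δ<p)
    (ℚ.≤-trans p²≤ (ℚ.≤-reflexive (sym (ℚ.0≤p⇒∣p∣≡p (ℚ.≤-trans (square-nonneg p) p²≤)))))
    where
    p²≤ : p * p ≤ p * p + q * q
    p²≤ = subst (_≤ p * p + q * q) (ℚ.+-identityʳ (p * p))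
      (ℚ.+-monoʳ-≤ (p * p) (square-nonneg q))

  norm-boundʳ : ∀ {δ} p q → 0ℚ < δ → δ < ∣ q ∣ → δ * δ < ∣ p * p + q * q ∣
  norm-boundʳ {δ} p q 0<δ δ<q = subst (λ r → δ * δ < ∣ r ∣) (ℚ.+-comm (q * q) (p * p))
    (norm-boundˡ q p 0<δ δ<q)

open RationalEstimates

Sequence : Set
Sequence = ℕ → ℚ

infix 4 _∼_ _♯_

-- `s ∼ s` says that s is Cauchy; between Cauchy sequences, `s ∼ t` says that
-- s - t tends to 0.
_∼_ : Sequence → Sequence → Set
s ∼ t = ∀ ε → 0ℚ ℚ.< ε →
        ∃[ N ] (∀ m n → N ℕ.≤ m → N ℕ.≤ n → ℚ.∣ s m ℚ.- t n ∣ ℚ.< ε)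

-- s - t is eventually bounded away from 0; for Cauchy sequences this is the
-- constructive form of "the limits differ", classically equivalent to ¬ s ∼ t.
_♯_ : Sequence → Sequence → Set
s ♯ t = ∃[ δ ] 0ℚ ℚ.< δ × ∃[ N ] (∀ n → N ℕ.≤ n → δ ℚ.< ℚ.∣ s n ℚ.- t n ∣)

record ℝ : Set where
  no-eta-equality
  constructor mkℝ
  field
    seq    : Sequence
    cauchy : seq ∼ seq

open ℝ public

module Sequences where

  open Rat
  open +-*-Solver
  open ≡ using (refl; sym; trans)

  _⟨+⟩_ _⟨*⟩_ _⟨-⟩_ : Sequence → Sequence → Sequence
  (s ⟨+⟩ t) n = s n + t n
  (s ⟨*⟩ t) n = s n * t n
  (s ⟨-⟩ t) n = s n - t n

  ⟨-_⟩ ⟨inv_⟩ : Sequence → Sequence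
  ⟨- s ⟩ n = - s n
  ⟨inv s ⟩ n = inv (s n)

  ⊔ˡ : ∀ {a b n} → a ℕ.⊔ b ℕ.≤ n → a ℕ.≤ n
  ⊔ˡ {a} {b} = ℕ.m⊔n≤o⇒m≤o a b

  ⊔ʳ : ∀ {a b n} → a ℕ.⊔ b ℕ.≤ n → b ℕ.≤ n
  ⊔ʳ {a} {b} = ℕ.m⊔n≤o⇒n≤o a b

  ∼-sym : ∀ {s t} → s ∼ t → t ∼ s
  ∼-sym {s} {t} st ε 0<ε with st ε 0<ε
  ... | N , h = N , λ m n N≤m N≤n → subst (_< ε) (∣-∣-sym (s n) (t m)) (h n m N≤n N≤m)

  ∼-trans : ∀ {s t u} → s ∼ t → t ∼ u → s ∼ u
  ∼-trans {s} {t} {u} st tu ε 0<ε with st _ (half-pos 0<ε) | tu _ (half-pos 0<ε)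
  ... | N , h | M , k = N ℕ.⊔ M , λ m n N≤m N≤n →
    triangle< (s m) (t (N ℕ.⊔ M)) (u n)
      (h m (N ℕ.⊔ M) (⊔ˡ {N} {M} N≤m) (ℕ.m≤m⊔n N M))
      (k (N ℕ.⊔ M) n (ℕ.m≤n⊔m N M) (⊔ʳ {N} {M} N≤n))

  limit : ∀ {s t} → t ∼ t →
          (∀ ε → 0ℚ < ε → ∃[ N ] (∀ n → N ℕ.≤ n → ∣ s n - t n ∣ < ε)) → s ∼ t
  limit {s} {t} tt st ε 0<ε with st _ (half-pos 0<ε) | tt _ (half-pos 0<ε)
  ... | N , h | M , k = N ℕ.⊔ M , λ m n N≤m N≤n →
    triangle< (s m) (t m) (t n) (h m (⊔ˡ {N} {M} N≤m))
      (k m n (⊔ʳ {N} {M} N≤m) (⊔ʳ {N} {M} N≤n))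

  eventually : ∀ {s t} → t ∼ t → ∃[ N ] (∀ n → N ℕ.≤ n → s n ≡ t n) → s ∼ t
  eventually {s} {t} tt (N , h) = limit {s} {t} tt λ ε 0<ε → N , λ n N≤n →
    subst (λ p → ∣ p - t n ∣ < ε) (sym (h n N≤n))
      (subst (λ p → ∣ p ∣ < ε) (sym (ℚ.+-inverseʳ (t n))) 0<ε)

  pointwise : ∀ {s t} → t ∼ t → (∀ n → s n ≡ t n) → s ∼ t
  pointwise {s} {t} tt h = eventually {s} {t} tt (0 , λ n _ → h n)

  constant : ∀ q → (λ _ → q) ∼ (λ _ → q)
  constant q ε 0<ε = 0 , λ _ _ _ _ → subst (λ p → ∣ p ∣ < ε) (sym (ℚ.+-inverseʳ q)) 0<ε

  ⟨+⟩-cong : ∀ {s s′ t t′} → s ∼ s′ → t ∼ t′ → s ⟨+⟩ t ∼ s′ ⟨+⟩ t′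
  ⟨+⟩-cong {s} {s′} {t} {t′} ss tt ε 0<ε with ss _ (half-pos 0<ε) | tt _ (half-pos 0<ε)
  ... | N , h | M , k = N ℕ.⊔ M , λ m n N≤m N≤n →
    +-close (s m) (s′ n) (t m) (t′ n)
      (h m n (⊔ˡ {N} {M} N≤m) (⊔ˡ {N} {M} N≤n))
      (k m n (⊔ʳ {N} {M} N≤m) (⊔ʳ {N} {M} N≤n))

  neg-cong : ∀ {s s′} → s ∼ s′ → ⟨- s ⟩ ∼ ⟨- s′ ⟩
  neg-cong {s} {s′} ss ε 0<ε with ss ε 0<ε
  ... | N , h = N , λ m n N≤m N≤n → subst (_< ε)
    (trans (∣-∣-sym (s m) (s′ n))
      (cong ∣_∣ (solve 2 (λ p q → q :- p := :- p :- :- q) refl (s m) (s′ n))))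
    (h m n N≤m N≤n)

  bounded : ∀ {s} → s ∼ s → ∃[ A ] 0ℚ < A × ∃[ N ] (∀ n → N ℕ.≤ n → ∣ s n ∣ ≤ A)
  bounded {s} ss with ss 1ℚ 0<1
  ... | N , h = 1ℚ + ∣ s N ∣
    , ℚ.<-≤-trans 0<1 (subst (_≤ 1ℚ + ∣ s N ∣) (ℚ.+-identityʳ 1ℚ) (ℚ.+-monoʳ-≤ 1ℚ (ℚ.0≤∣p∣ (s N))))
    , N , λ n N≤n → ℚ.≤-trans (∣p∣≤∣p-q∣+∣q∣ (s n) (s N))
                      (ℚ.+-monoˡ-≤ ∣ s N ∣ (ℚ.<⇒≤ (h n N N≤n ℕ.≤-refl)))

  ⟨*⟩-cong : ∀ {s s′ t t′} → s ∼ s → t′ ∼ t′ → s ∼ s′ → t ∼ t′ → s ⟨*⟩ t ∼ s′ ⟨*⟩ t′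
  ⟨*⟩-cong {s} {s′} {t} {t′} s∼s t′∼t′ ss tt ε 0<ε =
    let A , 0<A , N₁ , a      = bounded {s} s∼s
        B , 0<B , N₂ , b      = bounded {t′} t′∼t′
        A⁻¹ , 0<A⁻¹ , AA⁻¹≡1 = recip 0<A
        B⁻¹ , 0<B⁻¹ , BB⁻¹≡1 = recip 0<B
        N₃ , h = tt (A⁻¹ * (½ * ε)) (*-pos 0<A⁻¹ (half-pos 0<ε))
        N₄ , k = ss (B⁻¹ * (½ * ε)) (*-pos 0<B⁻¹ (half-pos 0<ε))
        M₁ = N₁ ℕ.⊔ N₂
        M₂ = N₃ ℕ.⊔ N₄
    in M₁ ℕ.⊔ M₂ , λ m n N≤m N≤n →
      *-close {A} {A⁻¹} {B} {B⁻¹} {ε} (s m) (s′ n) (t m) (t′ n) 0<A AA⁻¹≡1 0<B BB⁻¹≡1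
        (a m (⊔ˡ {N₁} {N₂} (⊔ˡ {M₁} {M₂} N≤m)))
        (b n (⊔ʳ {N₁} {N₂} (⊔ˡ {M₁} {M₂} N≤n)))
        (h m n (⊔ˡ {N₃} {N₄} (⊔ʳ {M₁} {M₂} N≤m)) (⊔ˡ {N₃} {N₄} (⊔ʳ {M₁} {M₂} N≤n)))
        (k m n (⊔ʳ {N₃} {N₄} (⊔ʳ {M₁} {M₂} N≤m)) (⊔ʳ {N₃} {N₄} (⊔ʳ {M₁} {M₂} N≤n)))

  inv-cauchy : ∀ {s δ} → s ∼ s → 0ℚ < δ → ∃[ N ] (∀ n → N ℕ.≤ n → δ < ∣ s n ∣) →
               ⟨inv s ⟩ ∼ ⟨inv s ⟩
  inv-cauchy {s} {δ} ss 0<δ (N , h) ε 0<ε =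
    let r , 0<r , δr≡1 = recip 0<δ
        M , k = ss (δ * δ * ε) (*-pos (*-pos 0<δ 0<δ) 0<ε)
    in N ℕ.⊔ M , λ m n N≤m N≤n →
      let δ<m = h m (⊔ˡ {N} {M} N≤m)
          δ<n = h n (⊔ˡ {N} {M} N≤n)
      in reciprocals-close {δ} {r} {ε} (s m) (s n) (inv (s m)) (inv (s n)) 0<r δr≡1
           (inv-inverse {δ} {s m} 0<δ δ<m) (inv-inverse {δ} {s n} 0<δ δ<n)
           (inv-bound {δ} {r} {s m} 0<δ 0<r δr≡1 δ<m) (inv-bound {δ} {r} {s n} 0<δ 0<r δr≡1 δ<n)
           (k n m (⊔ʳ {N} {M} N≤n) (⊔ʳ {N} {M} N≤m))

  -- Away from its start, a Cauchy sequence with one large term stays large.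
  persists : ∀ {s δ} → s ∼ s → 0ℚ < δ →
             ∃[ N ] (∀ k → N ℕ.≤ k → δ < ∣ s k ∣ → ∀ n → N ℕ.≤ n → ½ * δ < ∣ s n ∣)
  persists {s} {δ} ss 0<δ with ss _ (half-pos 0<δ)
  ... | N , h = N , λ k N≤k δ<k n N≤n → ℚ.≰⇒> λ n≤ → ℚ.<-irrefl refl
    (ℚ.<-≤-trans δ<k (ℚ.≤-trans (∣p∣≤∣p-q∣+∣q∣ (s k) (s n))
      (subst (∣ s k - s n ∣ + ∣ s n ∣ ≤_) (halves δ)
        (ℚ.+-mono-≤ (ℚ.<⇒≤ (h k n N≤k N≤n)) n≤))))

  ⟨-⟩-cong : ∀ {s s′ t t′} → s ∼ s′ → t ∼ t′ → s ⟨-⟩ t ∼ s′ ⟨-⟩ t′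
  ⟨-⟩-cong {s} {s′} {t} {t′} ss tt = ⟨+⟩-cong {s} {s′} {⟨- t ⟩} {⟨- t′ ⟩} ss (neg-cong {t} {t′} tt)

  ♯-irrefl : ∀ {s t} → s ∼ t → ¬ s ♯ t
  ♯-irrefl st (δ , 0<δ , N , h) with st δ 0<δ
  ... | M , k = ℚ.<-asym (h (N ℕ.⊔ M) (ℕ.m≤m⊔n N M))
    (k (N ℕ.⊔ M) (N ℕ.⊔ M) (ℕ.m≤n⊔m N M) (ℕ.m≤n⊔m N M))

  ♯-sym : ∀ {s t} → s ♯ t → t ♯ s
  ♯-sym {s} {t} (δ , 0<δ , N , h) = δ , 0<δ , N , λ n N≤n →
    subst (δ <_) (∣-∣-sym (s n) (t n)) (h n N≤n)

  ♯-cotrans : ∀ {s t u} → s ∼ s → t ∼ t → u ∼ u → s ♯ t → (s ♯ u) ⊎ (u ♯ t)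
  ♯-cotrans {s} {t} {u} ss tt uu (δ , 0<δ , N , h) = decide (½ * δ ℚ.<? ∣ s K - u K ∣)
    where
    su = persists {s ⟨-⟩ u} {½ * δ} (⟨-⟩-cong {s} {s} {u} {u} ss uu) (half-pos 0<δ)
    ut = persists {u ⟨-⟩ t} {½ * δ} (⟨-⟩-cong {u} {u} {t} {t} uu tt) (half-pos 0<δ)
    N₁ = proj₁ su
    N₂ = proj₁ ut
    K  = N ℕ.⊔ (N₁ ℕ.⊔ N₂)
    N₁⊔N₂≤K : N₁ ℕ.⊔ N₂ ℕ.≤ K
    N₁⊔N₂≤K = ℕ.m≤n⊔m N (N₁ ℕ.⊔ N₂)
    decide : Dec (½ * δ < ∣ s K - u K ∣) → (s ♯ u) ⊎ (u ♯ t)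
    decide (yes far) = inj₁ (½ * (½ * δ) , half-pos (half-pos 0<δ) , N₁ ,
      proj₂ su K (⊔ˡ {N₁} {N₂} N₁⊔N₂≤K) far)
    decide (no near) = inj₂ (½ * (½ * δ) , half-pos (half-pos 0<δ) , N₂ ,
      proj₂ ut K (⊔ʳ {N₁} {N₂} N₁⊔N₂≤K) (ℚ.≰⇒> λ near′ → ℚ.<-irrefl refl
        (ℚ.<-≤-trans (h K (ℕ.m≤m⊔n N (N₁ ℕ.⊔ N₂))) (ℚ.≤-trans (triangle (s K) (u K) (t K))
          (subst (∣ s K - u K ∣ + ∣ u K - t K ∣ ≤_) (halves δ)
            (ℚ.+-mono-≤ (ℚ.≮⇒≥ near) near′))))))

  ♯-tight : ∀ {s t} → s ∼ s → t ∼ t → ¬ s ♯ t → s ∼ t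
  ♯-tight {s} {t} ss tt ¬st = limit {s} {t} tt λ ε 0<ε →
    let dd    = ⟨-⟩-cong {s} {s} {t} {t} ss tt
        N , h = persists {s ⟨-⟩ t} dd (half-pos 0<ε)
        M , k = dd (½ * ε) (half-pos 0<ε)
        K     = N ℕ.⊔ M
    in K , λ n K≤n → ℚ.≤-<-trans (∣p∣≤∣p-q∣+∣q∣ (s n - t n) (s K - t K))
         (subst (∣ (s n - t n) - (s K - t K) ∣ + ∣ s K - t K ∣ <_) (halves ε)
           (ℚ.+-mono-<-≤ (k n K (⊔ʳ {N} {M} K≤n) (ℕ.m≤n⊔m N M))
             (ℚ.≮⇒≥ λ far → ¬st (½ * (½ * ε) , half-pos (half-pos 0<ε) , N ,
               h K (ℕ.m≤m⊔n N M) far))))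

  unit⇒♯ : ∀ {s t u} → u ∼ u → (s ⟨-⟩ t) ⟨*⟩ u ∼ (λ _ → 1ℚ) → s ♯ t
  unit⇒♯ {s} {t} {u} uu eq =
    let B , 0<B , N , b = bounded {u} uu
        M , h = eq ½ (ℚ.positive⁻¹ ½)
        r , 0<r , Br≡1 = recip 0<B
        half : ½ * r * B ≡ ½
        half = trans (solve 2 (λ r B → con ½ :* r :* B := con ½ :* (B :* r)) refl r B)
                     (cong (½ *_) Br≡1)
    in ½ * r , half-pos 0<r , N ℕ.⊔ M , λ n K≤n → ℚ.≰⇒> λ small →
      let d = s n - t n
      in ℚ.<-irrefl refl (ℚ.≤-<-trans
        (∣p∣≤∣p-q∣+∣q∣ 1ℚ (d * u n))
        (ℚ.+-mono-<-≤ {∣ 1ℚ - d * u n ∣} {½}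
          (subst (_< ½) (∣-∣-sym (d * u n) 1ℚ) (h n n (⊔ʳ {N} {M} K≤n) (⊔ʳ {N} {M} K≤n)))
          (subst (∣ d * u n ∣ ≤_) half
            (*-mono-∣∣ d (u n) small (b n (⊔ˡ {N} {M} K≤n))))))

  Away : Sequence → Set
  Away s = ∃[ δ ] 0ℚ < δ × ∃[ N ] (∀ n → N ℕ.≤ n → δ < ∣ s n ∣)

  inv-unit : ∀ {s} → Away s → s ⟨*⟩ ⟨inv s ⟩ ∼ (λ _ → 1ℚ)
  inv-unit {s} (δ , 0<δ , N , h) = eventually {s ⟨*⟩ ⟨inv s ⟩} {λ _ → 1ℚ} (constant 1ℚ)
    (N , λ n N≤n → inv-inverse {δ} {s n} 0<δ (h n N≤n))

  factor-unit : ∀ {s t u} → s ∼ s → t ∼ t → u ∼ u → Away u → s ⟨*⟩ t ∼ u →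
                Σ Sequence λ v → v ∼ v × s ⟨*⟩ v ∼ (λ _ → 1ℚ)
  factor-unit {s} {t} {u} ss tt uu away@(δ , 0<δ , large) st =
    t ⟨*⟩ ⟨inv u ⟩ , ⟨*⟩-cong {t} {t} {⟨inv u ⟩} {⟨inv u ⟩} tt u⁻¹ tt u⁻¹ ,
    ∼-trans {s ⟨*⟩ (t ⟨*⟩ ⟨inv u ⟩)} {(s ⟨*⟩ t) ⟨*⟩ ⟨inv u ⟩} {λ _ → 1ℚ}
      (pointwise {s ⟨*⟩ (t ⟨*⟩ ⟨inv u ⟩)} {(s ⟨*⟩ t) ⟨*⟩ ⟨inv u ⟩}
        (⟨*⟩-cong {s ⟨*⟩ t} {s ⟨*⟩ t} {⟨inv u ⟩} {⟨inv u ⟩} st∼st u⁻¹ st∼st u⁻¹)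
        (λ n → sym (ℚ.*-assoc (s n) (t n) (inv (u n)))))
      (∼-trans {(s ⟨*⟩ t) ⟨*⟩ ⟨inv u ⟩} {u ⟨*⟩ ⟨inv u ⟩} {λ _ → 1ℚ}
        (⟨*⟩-cong {s ⟨*⟩ t} {u} {⟨inv u ⟩} {⟨inv u ⟩} st∼st u⁻¹ st u⁻¹)
        (inv-unit {u} away))
    where
    u⁻¹ = inv-cauchy {u} {δ} uu 0<δ large
    st∼st = ⟨*⟩-cong {s} {s} {t} {t} ss tt ss tt

  1♯0 : (λ _ → 1ℚ) ♯ (λ _ → 0ℚ)
  1♯0 = ½ , ℚ.positive⁻¹ ½ , 0 , λ _ _ → ½<1
    where
    ½<1 : ½ < 1ℚ
    ½<1 = half< 0<1

  -- If (a + bi)(c + di) has real part 1, then a or b is invertible.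
  unit-cases : ∀ {a b c d} → a ∼ a → b ∼ b → c ∼ c → d ∼ d →
               (a ⟨*⟩ c) ⟨-⟩ (b ⟨*⟩ d) ∼ (λ _ → 1ℚ) →
               (Σ Sequence λ v → v ∼ v × a ⟨*⟩ v ∼ (λ _ → 1ℚ)) ⊎
               (Σ Sequence λ v → v ∼ v × b ⟨*⟩ v ∼ (λ _ → 1ℚ))
  unit-cases {a} {b} {c} {d} aa bb cc dd eq =
    decide (♯-cotrans {λ _ → 1ℚ} {λ _ → 0ℚ} {a ⟨*⟩ c} (constant 1ℚ) (constant 0ℚ) ac 1♯0)
    where
    ac : a ⟨*⟩ c ∼ a ⟨*⟩ c
    ac = ⟨*⟩-cong {a} {a} {c} {c} aa cc aa cc
    bd : b ⟨*⟩ d ∼ b ⟨*⟩ d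
    bd = ⟨*⟩-cong {b} {b} {d} {d} bb dd bb dd
    ac-1 : Sequence
    ac-1 = (a ⟨*⟩ c) ⟨-⟩ (λ _ → 1ℚ)
    ac-1∼ac-1 : ac-1 ∼ ac-1
    ac-1∼ac-1 = ⟨-⟩-cong {a ⟨*⟩ c} {a ⟨*⟩ c} {λ _ → 1ℚ} {λ _ → 1ℚ} ac (constant 1ℚ)
    bd∼ac-1 : b ⟨*⟩ d ∼ ac-1
    bd∼ac-1 = ∼-trans {b ⟨*⟩ d} {(a ⟨*⟩ c) ⟨-⟩ ((a ⟨*⟩ c) ⟨-⟩ (b ⟨*⟩ d))} {ac-1}
      (∼-sym {(a ⟨*⟩ c) ⟨-⟩ ((a ⟨*⟩ c) ⟨-⟩ (b ⟨*⟩ d))} {b ⟨*⟩ d}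
        (pointwise {(a ⟨*⟩ c) ⟨-⟩ ((a ⟨*⟩ c) ⟨-⟩ (b ⟨*⟩ d))} {b ⟨*⟩ d} bd
          (λ n → solve 2 (λ p q → p :- (p :- q) := q) refl (a n * c n) (b n * d n))))
      (⟨-⟩-cong {a ⟨*⟩ c} {a ⟨*⟩ c} {(a ⟨*⟩ c) ⟨-⟩ (b ⟨*⟩ d)} {λ _ → 1ℚ} ac eq)
    decide : ((λ _ → 1ℚ) ♯ (a ⟨*⟩ c)) ⊎ ((a ⟨*⟩ c) ♯ (λ _ → 0ℚ)) →
             (Σ Sequence λ v → v ∼ v × a ⟨*⟩ v ∼ (λ _ → 1ℚ)) ⊎
             (Σ Sequence λ v → v ∼ v × b ⟨*⟩ v ∼ (λ _ → 1ℚ))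
    decide (inj₁ 1♯ac) = inj₂ (factor-unit {b} {d} {ac-1} bb dd ac-1∼ac-1
      (♯-sym {λ _ → 1ℚ} {a ⟨*⟩ c} 1♯ac) bd∼ac-1)
    decide (inj₂ (δ , 0<δ , N , h)) = inj₁ (factor-unit {a} {c} {a ⟨*⟩ c} aa cc ac
      (δ , 0<δ , N , λ n N≤n → subst (λ p → δ < ∣ p ∣) (ℚ.+-identityʳ (a n * c n)) (h n N≤n)) ac)

open Sequences

infixl 6 _+ʳ_ _-ʳ_
infixl 7 _*ʳ_
infix  8 -ʳ_

ratʳ : ℚ → ℝ
ratʳ q = mkℝ (λ _ → q) (constant q)

_+ʳ_ _*ʳ_ : ℝ → ℝ → ℝ
x +ʳ y = mkℝ (λ n → seq x n ℚ.+ seq y n)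
             (⟨+⟩-cong {seq x} {seq x} {seq y} {seq y} (cauchy x) (cauchy y))
x *ʳ y = mkℝ (λ n → seq x n ℚ.* seq y n)
             (⟨*⟩-cong {seq x} {seq x} {seq y} {seq y} (cauchy x) (cauchy y) (cauchy x) (cauchy y))

-ʳ_ : ℝ → ℝ
-ʳ x = mkℝ (λ n → ℚ.- seq x n) (neg-cong {seq x} {seq x} (cauchy x))

_-ʳ_ : ℝ → ℝ → ℝ
x -ʳ y = x +ʳ (-ʳ y)

record ℂ : Set where
  no-eta-equality
  constructor _+i_
  field
    re im : ℝ

open ℂ public

module ComplexField where

  open +-*-Solver
  open ≡ using (refl; sym; trans)

  infixl 6 _+_
  infixl 7 _*_
  infix  8 -_
  infix  4 _≈_ _#_

  -- Opaque so that unification does not unfold field operations into sequences.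
  opaque

    _≈_ _#_ : ℂ → ℂ → Set
    z ≈ w = seq (re z) ∼ seq (re w) × seq (im z) ∼ seq (im w)
    z # w = seq (re z) ♯ seq (re w) ⊎ seq (im z) ♯ seq (im w)

    _+_ _*_ : ℂ → ℂ → ℂ
    z + w = (re z +ʳ re w) +i (im z +ʳ im w)
    z * w = (re z *ʳ re w -ʳ im z *ʳ im w) +i (re z *ʳ im w +ʳ im z *ʳ re w)

    -_ : ℂ → ℂ
    - z = (-ʳ re z) +i (-ʳ im z)

    0# 1# : ℂ
    0# = ratʳ 0ℚ +i ratʳ 0ℚ
    1# = ratʳ 1ℚ +i ratʳ 0ℚ

    private

      ≈-pointwise : ∀ z w → (∀ n → seq (re z) n ≡ seq (re w) n) →
                    (∀ n → seq (im z) n ≡ seq (im w) n) → z ≈ w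
      ≈-pointwise z w r i = pointwise {seq (re z)} {seq (re w)} (cauchy (re w)) r
                          , pointwise {seq (im z)} {seq (im w)} (cauchy (im w)) i

      ≈-refl : ∀ {z} → z ≈ z
      ≈-refl {z} = cauchy (re z) , cauchy (im z)

      ≈-sym : ∀ {z w} → z ≈ w → w ≈ z
      ≈-sym {z} {w} (r , i) = ∼-sym {seq (re z)} {seq (re w)} r , ∼-sym {seq (im z)} {seq (im w)} i

      ≈-trans : ∀ {z w v} → z ≈ w → w ≈ v → z ≈ v
      ≈-trans {z} {w} {v} (r , i) (r′ , i′) =
        ∼-trans {seq (re z)} {seq (re w)} {seq (re v)} r r′ ,
        ∼-trans {seq (im z)} {seq (im w)} {seq (im v)} i i′

      ℂ-+-cong : ∀ {z z′ w w′} → z ≈ z′ → w ≈ w′ → z + w ≈ z′ + w′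
      ℂ-+-cong {z} {z′} {w} {w′} (r , i) (r′ , i′) =
        ⟨+⟩-cong {seq (re z)} {seq (re z′)} {seq (re w)} {seq (re w′)} r r′ ,
        ⟨+⟩-cong {seq (im z)} {seq (im z′)} {seq (im w)} {seq (im w′)} i i′

      ℂ-neg-cong : ∀ {z w} → z ≈ w → - z ≈ - w
      ℂ-neg-cong {z} {w} (r , i) =
        neg-cong {seq (re z)} {seq (re w)} r , neg-cong {seq (im z)} {seq (im w)} i

      *ʳ-cong : ∀ x x′ y y′ → seq x ∼ seq x′ → seq y ∼ seq y′ → seq (x *ʳ y) ∼ seq (x′ *ʳ y′)
      *ʳ-cong x x′ y y′ = ⟨*⟩-cong {seq x} {seq x′} {seq y} {seq y′} (cauchy x) (cauchy y′)

      ℂ-*-cong : ∀ {z z′ w w′} → z ≈ z′ → w ≈ w′ → z * w ≈ z′ * w′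
      ℂ-*-cong {z} {z′} {w} {w′} (r , i) (r′ , i′) =
        ⟨-⟩-cong {seq (re z *ʳ re w)} {seq (re z′ *ʳ re w′)} {seq (im z *ʳ im w)} {seq (im z′ *ʳ im w′)}
          (*ʳ-cong (re z) (re z′) (re w) (re w′) r r′) (*ʳ-cong (im z) (im z′) (im w) (im w′) i i′) ,
        ⟨+⟩-cong {seq (re z *ʳ im w)} {seq (re z′ *ʳ im w′)} {seq (im z *ʳ re w)} {seq (im z′ *ʳ re w′)}
          (*ʳ-cong (re z) (re z′) (im w) (im w′) r i′) (*ʳ-cong (im z) (im z′) (re w) (re w′) i r′)

      ℂ-+-assoc : ∀ z w v → (z + w) + v ≈ z + (w + v)
      ℂ-+-assoc z w v = ≈-pointwise ((z + w) + v) (z + (w + v))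
        (λ n → ℚ.+-assoc (seq (re z) n) (seq (re w) n) (seq (re v) n))
        (λ n → ℚ.+-assoc (seq (im z) n) (seq (im w) n) (seq (im v) n))

      ℂ-+-comm : ∀ z w → z + w ≈ w + z
      ℂ-+-comm z w = ≈-pointwise (z + w) (w + z)
        (λ n → ℚ.+-comm (seq (re z) n) (seq (re w) n))
        (λ n → ℚ.+-comm (seq (im z) n) (seq (im w) n))

      ℂ-+-identityˡ : ∀ z → 0# + z ≈ z
      ℂ-+-identityˡ z = ≈-pointwise (0# + z) z
        (λ n → ℚ.+-identityˡ (seq (re z) n)) (λ n → ℚ.+-identityˡ (seq (im z) n))

      ℂ-+-identityʳ : ∀ z → z + 0# ≈ z
      ℂ-+-identityʳ z = ≈-pointwise (z + 0#) z
        (λ n → ℚ.+-identityʳ (seq (re z) n)) (λ n → ℚ.+-identityʳ (seq (im z) n))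

      ℂ-+-inverseˡ : ∀ z → - z + z ≈ 0#
      ℂ-+-inverseˡ z = ≈-pointwise (- z + z) 0#
        (λ n → ℚ.+-inverseˡ (seq (re z) n)) (λ n → ℚ.+-inverseˡ (seq (im z) n))

      ℂ-+-inverseʳ : ∀ z → z + - z ≈ 0#
      ℂ-+-inverseʳ z = ≈-pointwise (z + - z) 0#
        (λ n → ℚ.+-inverseʳ (seq (re z) n)) (λ n → ℚ.+-inverseʳ (seq (im z) n))

      ℂ-*-assoc : ∀ z w v → (z * w) * v ≈ z * (w * v)
      ℂ-*-assoc z w v = ≈-pointwise ((z * w) * v) (z * (w * v))
        (λ n → solve 6 (λ a b c d e f →
          (a :* c :- b :* d) :* e :- (a :* d :+ b :* c) :* f :=
          a :* (c :* e :- d :* f) :- b :* (c :* f :+ d :* e)) refl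
          (seq (re z) n) (seq (im z) n) (seq (re w) n) (seq (im w) n) (seq (re v) n) (seq (im v) n))
        (λ n → solve 6 (λ a b c d e f →
          (a :* c :- b :* d) :* f :+ (a :* d :+ b :* c) :* e :=
          a :* (c :* f :+ d :* e) :+ b :* (c :* e :- d :* f)) refl
          (seq (re z) n) (seq (im z) n) (seq (re w) n) (seq (im w) n) (seq (re v) n) (seq (im v) n))

      ℂ-*-comm : ∀ z w → z * w ≈ w * z
      ℂ-*-comm z w = ≈-pointwise (z * w) (w * z)
        (λ n → solve 4 (λ a b c d → a :* c :- b :* d := c :* a :- d :* b) refl
          (seq (re z) n) (seq (im z) n) (seq (re w) n) (seq (im w) n))
        (λ n → solve 4 (λ a b c d → a :* d :+ b :* c := c :* b :+ d :* a) refl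
          (seq (re z) n) (seq (im z) n) (seq (re w) n) (seq (im w) n))

      ℂ-*-identityˡ : ∀ z → 1# * z ≈ z
      ℂ-*-identityˡ z = ≈-pointwise (1# * z) z
        (λ n → solve 2 (λ a b → con 1ℚ :* a :- con 0ℚ :* b := a) refl (seq (re z) n) (seq (im z) n))
        (λ n → solve 2 (λ a b → con 1ℚ :* b :+ con 0ℚ :* a := b) refl (seq (re z) n) (seq (im z) n))

      ℂ-distribˡ : ∀ z w v → z * (w + v) ≈ z * w + z * v
      ℂ-distribˡ z w v = ≈-pointwise (z * (w + v)) (z * w + z * v)
        (λ n → solve 6 (λ a b c d e f →
          a :* (c :+ e) :- b :* (d :+ f) := (a :* c :- b :* d) :+ (a :* e :- b :* f)) refl
          (seq (re z) n) (seq (im z) n) (seq (re w) n) (seq (im w) n) (seq (re v) n) (seq (im v) n))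
        (λ n → solve 6 (λ a b c d e f →
          a :* (d :+ f) :+ b :* (c :+ e) := (a :* d :+ b :* c) :+ (a :* f :+ b :* e)) refl
          (seq (re z) n) (seq (im z) n) (seq (re w) n) (seq (im w) n) (seq (re v) n) (seq (im v) n))

      ≈-byComm : ∀ {z w v} → z * w ≈ v → w * z ≈ v
      ≈-byComm {z} {w} {v} = ≈-trans {w * z} {z * w} {v} (ℂ-*-comm w z)

    isCommutativeRing : IsCommutativeRing _≈_ _+_ _*_ -_ 0# 1#
    isCommutativeRing = record
      { isRing = record
        { +-isAbelianGroup = record
          { isGroup = record
            { isMonoid = record
              { isSemigroup = record
                { isMagma = record
                  { isEquivalence = record
                    { refl  = λ {z} → ≈-refl {z}
                    ; sym   = λ {z w} → ≈-sym {z} {w}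
                    ; trans = λ {z w v} → ≈-trans {z} {w} {v}
                    }
                  ; ∙-cong = λ {z z′ w w′} → ℂ-+-cong {z} {z′} {w} {w′}
                  }
                ; assoc = ℂ-+-assoc
                }
              ; identity = ℂ-+-identityˡ , ℂ-+-identityʳ
              }
            ; inverse = ℂ-+-inverseˡ , ℂ-+-inverseʳ
            ; ⁻¹-cong = λ {z w} → ℂ-neg-cong {z} {w}
            }
          ; comm = ℂ-+-comm
          }
        ; *-cong     = λ {z z′ w w′} → ℂ-*-cong {z} {z′} {w} {w′}
        ; *-assoc    = ℂ-*-assoc
        ; *-identity = ℂ-*-identityˡ , λ z → ≈-byComm {1#} {z} {z} (ℂ-*-identityˡ z)
        ; distrib    = ℂ-distribˡ , λ z w v →
            ≈-byComm {z} {w + v} {w * z + v * z}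
              (≈-trans {z * (w + v)} {z * w + z * v} {w * z + v * z} (ℂ-distribˡ z w v)
                (ℂ-+-cong {z * w} {w * z} {z * v} {v * z} (ℂ-*-comm z w) (ℂ-*-comm z v)))
        }
      ; *-comm = ℂ-*-comm
      }

    private

      #-cotrans : ∀ {z w} → z # w → ∀ v → z # v ⊎ v # w
      #-cotrans {z} {w} (inj₁ r) v = Sum.map inj₁ inj₁
        (♯-cotrans {seq (re z)} {seq (re w)} {seq (re v)} (cauchy (re z)) (cauchy (re w)) (cauchy (re v)) r)
      #-cotrans {z} {w} (inj₂ i) v = Sum.map inj₂ inj₂
        (♯-cotrans {seq (im z)} {seq (im w)} {seq (im v)} (cauchy (im z)) (cauchy (im w)) (cauchy (im v)) i)

      #-irrefl : ∀ {z w} → z ≈ w → ¬ z # w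
      #-irrefl {z} {w} (r , _) (inj₁ z#w) = ♯-irrefl {seq (re z)} {seq (re w)} r z#w
      #-irrefl {z} {w} (_ , i) (inj₂ z#w) = ♯-irrefl {seq (im z)} {seq (im w)} i z#w

      #-sym : ∀ {z w} → z # w → w # z
      #-sym {z} {w} (inj₁ r) = inj₁ (♯-sym {seq (re z)} {seq (re w)} r)
      #-sym {z} {w} (inj₂ i) = inj₂ (♯-sym {seq (im z)} {seq (im w)} i)

      tight : ∀ z w → (¬ z # w → z ≈ w) × (z ≈ w → ¬ z # w)
      tight z w = (λ ¬z#w →
          ♯-tight {seq (re z)} {seq (re w)} (cauchy (re z)) (cauchy (re w)) (λ r → ¬z#w (inj₁ r)) ,
          ♯-tight {seq (im z)} {seq (im w)} (cauchy (im z)) (cauchy (im w)) (λ i → ¬z#w (inj₂ i)))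
        , #-irrefl {z} {w}

      ∣_∣² : ℂ → ℝ
      ∣ z ∣² = re z *ʳ re z +ʳ im z *ʳ im z

      norm-away : ∀ z w → z # w → Away (seq ∣ z + - w ∣²)
      norm-away z w (inj₁ (δ , 0<δ , N , h)) = δ ℚ.* δ , *-pos 0<δ 0<δ , N , λ n N≤n →
        norm-boundˡ (seq (re z) n ℚ.- seq (re w) n) (seq (im z) n ℚ.- seq (im w) n) 0<δ (h n N≤n)
      norm-away z w (inj₂ (δ , 0<δ , N , h)) = δ ℚ.* δ , *-pos 0<δ 0<δ , N , λ n N≤n →
        norm-boundʳ (seq (re z) n ℚ.- seq (re w) n) (seq (im z) n ℚ.- seq (im w) n) 0<δ (h n N≤n)

      invʳ : (x : ℝ) → Away (seq x) → ℝ
      invʳ x (δ , 0<δ , large) = mkℝ (λ n → inv (seq x n)) (inv-cauchy {seq x} {δ} (cauchy x) 0<δ large)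

      invᶜ : (z : ℂ) → Away (seq ∣ z ∣²) → ℂ
      invᶜ z away = (re z *ʳ invʳ ∣ z ∣² away) +i (-ʳ (im z *ʳ invʳ ∣ z ∣² away))

      invᶜ-inverse : ∀ z away → z * invᶜ z away ≈ 1#
      invᶜ-inverse z away =
        ∼-trans {seq (re (z * invᶜ z away))} {seq (∣ z ∣² *ʳ invʳ ∣ z ∣² away)} {λ _ → 1ℚ}
          (pointwise {seq (re (z * invᶜ z away))} {seq (∣ z ∣² *ʳ invʳ ∣ z ∣² away)}
            (cauchy (∣ z ∣² *ʳ invʳ ∣ z ∣² away))
            (λ n → solve 3 (λ a b x → a :* (a :* x) :- b :* (:- (b :* x)) := (a :* a :+ b :* b) :* x) refl
              (seq (re z) n) (seq (im z) n) (inv (seq ∣ z ∣² n))))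
          (inv-unit {seq ∣ z ∣²} away) ,
        pointwise {seq (im (z * invᶜ z away))} {λ _ → 0ℚ} (constant 0ℚ)
          (λ n → solve 3 (λ a b x → a :* (:- (b :* x)) :+ b :* (a :* x) := con 0ℚ) refl
              (seq (re z) n) (seq (im z) n) (inv (seq ∣ z ∣² n)))

      #⇒invertible : ∀ {z w} → z # w → Invertible _≈_ 1# _*_ (z + - w)
      #⇒invertible {z} {w} z#w = v , ≈-byComm {z + - w} {v} {1#} eq , eq
        where
        v : ℂ
        v = invᶜ (z + - w) (norm-away z w z#w)
        eq : (z + - w) * v ≈ 1#
        eq = invᶜ-inverse (z + - w) (norm-away z w z#w)

      invertible⇒# : ∀ {z w} → Invertible _≈_ 1# _*_ (z + - w) → z # w
      invertible⇒# {z} {w} (v , _ , r , _) = Sum.map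
        (λ (u , uu , eq) → unit⇒♯ {seq (re z)} {seq (re w)} {u} uu eq)
        (λ (u , uu , eq) → unit⇒♯ {seq (im z)} {seq (im w)} {u} uu eq)
        (unit-cases {seq (re (z + - w))} {seq (im (z + - w))} {seq (re v)} {seq (im v)}
          (cauchy (re (z + - w))) (cauchy (im (z + - w))) (cauchy (re v)) (cauchy (im v)) r)

    isHeytingField : IsHeytingField _≈_ _#_ _+_ _*_ -_ 0# 1#
    isHeytingField = record
      { isHeytingCommutativeRing = record
        { isCommutativeRing   = isCommutativeRing
        ; isApartnessRelation = record
          { irrefl  = λ {z w} → #-irrefl {z} {w}
          ; sym     = λ {z w} → #-sym {z} {w}
          ; cotrans = λ {z w} → #-cotrans {z} {w}
          }
        ; #⇒invertible = λ {z w} → #⇒invertible {z} {w}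
        ; invertible⇒# = λ {z w} → invertible⇒# {z} {w}
        }
      ; tight = tight
      }

ℂ-heytingField : HeytingField 0ℓ 0ℓ 0ℓ
ℂ-heytingField = record { isHeytingField = ComplexField.isHeytingField }

module Identities {c ℓ₁ ℓ₂} (K : HeytingField c ℓ₁ ℓ₂) where

  open HeytingField K
  open HeytingProperties heytingCommutativeRing

  private
    R : CommutativeRing c ℓ₁
    R = HeytingCommutativeRing.commutativeRing heytingCommutativeRing

  open CommutativeRing R using (ring; semiring)
  open import Algebra.Properties.Ring ring using (-‿involutive; -0#≈0#; -‿+-comm)
  open import Algebra.Properties.Semiring.Mult semiring using (×-homo-+) renaming (_×_ to _·_)
  open import Algebra.Properties.Semiring.Exp semiring public using (_^_)
  open import Algebra.Properties.Semiring.Sum semiring public using (sum-syntax; sum⁺-syntax)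
  open import Relation.Binary.Reasoning.Setoid setoid

  fromℕ : ℕ → Carrier
  fromℕ n = n · 1#

  fromℤ : ℤ → Carrier
  fromℤ (ℤ.+ n)    = fromℕ n
  fromℤ ℤ.-[1+ n ] = - fromℕ (suc n)

  infixl 7 _/_⟨_⟩

  -- `#⇒invertible` inverts `b - 0#`, which equals b.
  _/_⟨_⟩ : (a b : Carrier) → b # 0# → Carrier
  a / b ⟨ b#0 ⟩ = a * proj₁ (#⇒invertible b#0)

  -- Abstract, because comparing denominators' proofs by unfolding them is slow.
  abstract

    private

      #-transport : ∀ {a b a′ b′} → a - b ≈ a′ - b′ → a # b → a′ # b′
      #-transport eq a#b = let v , va≈1 , _ = #⇒invertible a#b in
        invertibleˡ⇒# (v , trans (*-congˡ (sym eq)) va≈1)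

      #-translate : ∀ {a b} d → a # b → a + d # b + d
      #-translate {a} {b} d = #-transport (sym (begin
        (a + d) - (b + d)       ≈⟨ +-congˡ (-‿+-comm b d) ⟨
        (a + d) + (- b - d)     ≈⟨ +-congˡ (+-comm (- b) (- d)) ⟩
        (a + d) + (- d - b)     ≈⟨ +-assoc a d (- d - b) ⟩
        a + (d + (- d - b))     ≈⟨ +-congˡ (+-assoc d (- d) (- b)) ⟨
        a + ((d - d) - b)       ≈⟨ +-congˡ (+-congʳ (-‿inverseʳ d)) ⟩
        a + (0# - b)            ≈⟨ +-congˡ (+-identityˡ (- b)) ⟩
        a - b                   ∎))

    a#b⇒a-b#0 : ∀ {a b} → a # b → a - b # 0#
    a#b⇒a-b#0 {a} {b} a#b = #-transport (sym (x-0≈x (a - b))) a#b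

    a#-b⇒a+b#0 : ∀ {a b} → a # - b → a + b # 0#
    a#-b⇒a+b#0 {a} {b} a#-b = #-congʳ (+-congˡ (-‿involutive b)) (a#b⇒a-b#0 a#-b)

    ^-#0 : ∀ {a} n → a # 0# → a ^ n # 0#
    ^-#0 zero    a#0 = 1#0
    ^-#0 (suc n) a#0 = x#0y#0→xy#0 a#0 (^-#0 n a#0)

    *-#0 : ∀ {a b} → a # 0# → b # 0# → a * b # 0#
    *-#0 = x#0y#0→xy#0

    /-#0 : ∀ {a b} (b#0 : b # 0#) → a # 0# → a / b ⟨ b#0 ⟩ # 0#
    /-#0 {a} {b} b#0 a#0 = let v , _ , bv≈1 = #⇒invertible b#0 in
      x#0y#0→xy#0 a#0 (invertibleˡ⇒# (b - 0# , trans (*-congˡ (x-0≈x v)) bv≈1))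

  -- The generalized harmonic number H_n^⟨ℓ⟩(u); the last argument says that none of
  -- u + 1, …, u + n vanishes.
  H : (ℓ n : ℕ) (u : Carrier) →
      (∀ k → 1 ℕ.≤ k → k ℕ.≤ n → u # - fromℕ k) → Carrier
  H ℓ n u u# = ∑[ i < n ] (let k = suc (toℕ i) in
    1# / (u + fromℕ k) ^ ℓ ⟨ ^-#0 ℓ (a#-b⇒a+b#0 (u# k (ℕ.s≤s ℕ.z≤n) (toℕ<n i))) ⟩)

  -- falling u k = u (u - 1) ⋯ (u - k + 1)
  falling : Carrier → ℕ → Carrier
  falling u zero    = 1#
  falling u (suc k) = falling u k * (u - fromℕ k)

  module CharacteristicZero (fromℕ#0 : ∀ n → fromℕ (suc n) # 0#) where

    abstract

      !#0 : ∀ k → fromℕ (k !) # 0#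
      !#0 k = subst (λ m → fromℕ m # 0#) (ℕ.suc-pred (k !) ⦃ k !≢0 ⦄) (fromℕ#0 (ℕ.pred (k !)))

    binom : Carrier → ℕ → Carrier
    binom u k = falling u k / fromℕ (k !) ⟨ !#0 k ⟩

    abstract

      falling#0 : ∀ u k → (∀ i → i ℕ.< k → u # fromℕ i) → falling u k # 0#
      falling#0 u zero    u# = 1#0
      falling#0 u (suc k) u# = x#0y#0→xy#0
        (falling#0 u k (λ i i<k → u# i (ℕ.m<n⇒m<1+n i<k))) (a#b⇒a-b#0 (u# k ℕ.≤-refl))

      binom#0 : ∀ u k → (∀ i → i ℕ.< k → u # fromℕ i) → binom u k # 0#
      binom#0 u k u# = /-#0 (!#0 k) (falling#0 u k u#)

      n[n-1]#0 : ∀ n → 2 ℕ.≤ n → fromℕ n * (fromℕ n - 1#) # 0#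
      n[n-1]#0 (suc (suc n)) _ = x#0y#0→xy#0 (fromℕ#0 (suc n))
        (a#b⇒a-b#0 (#-congˡ (+-identityˡ 1#)
          (#-congʳ (+-comm (fromℕ (suc n)) 1#) (#-translate 1# (fromℕ#0 n)))))
      n[n-1]#0 (suc zero) (ℕ.s≤s ())

      1+x-y#0 : ∀ n → 2 ℕ.≤ n → ∀ x y → (∀ k → 1 ℕ.≤ k → k ℕ.≤ n → x - y # - fromℕ k) →
                1# + x - y # 0#
      1+x-y#0 n 2≤n x y x-y# = #-congʳ
        (begin
          (x - y) + fromℕ 1 ≈⟨ +-congˡ (+-identityʳ 1#) ⟩
          (x - y) + 1#      ≈⟨ +-comm (x - y) 1# ⟩
          1# + (x - y)      ≈⟨ +-assoc 1# x (- y) ⟨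
          1# + x - y        ∎)
        (a#-b⇒a+b#0 (x-y# 1 ℕ.≤-refl (ℕ.≤-trans (ℕ.n≤1+n 1) 2≤n)))

      binom[x+n]#0 : ∀ n x → (∀ k → 1 ℕ.≤ k → k ℕ.≤ n → x # - fromℕ k) →
                     binom (x + fromℕ n) n # 0#
      binom[x+n]#0 n x x# = binom#0 (x + fromℕ n) n λ i i<n →
        let m = n ℕ.∸ i in
        #-congˡ
          (begin
            - fromℕ m + fromℕ n             ≡⟨ cong (λ k → - fromℕ m + fromℕ k) (ℕ.m∸n+n≡m (ℕ.<⇒≤ i<n)) ⟨
            - fromℕ m + fromℕ (m ℕ.+ i)     ≈⟨ +-congˡ (×-homo-+ 1# m i) ⟩
            - fromℕ m + (fromℕ m + fromℕ i) ≈⟨ +-assoc (- fromℕ m) (fromℕ m) (fromℕ i) ⟨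
            - fromℕ m + fromℕ m + fromℕ i   ≈⟨ +-congʳ (-‿inverseˡ (fromℕ m)) ⟩
            0# + fromℕ i                    ≈⟨ +-identityˡ (fromℕ i) ⟩
            fromℕ i                         ∎)
          (#-translate (fromℕ n) (x# m (ℕ.m<n⇒0<n∸m i<n) (ℕ.m∸n≤m n i)))

    module _ (n : ℕ) (y : Carrier)
             (y# : ∀ j → ℤ.- (ℤ.+ n) ℤ.≤ j → j ℤ.< ℤ.+ n → y # fromℤ j) where

      abstract

        private

          y#+ : ∀ j → j ℕ.< n → y # fromℕ j
          y#+ j j<n = y# (ℤ.+ j) (ℤ.neg-≤-pos {n} {j}) (ℤ.+<+ j<n)

          y#- : ∀ k → 1 ℕ.≤ n → k ℕ.≤ n → y # - fromℕ k
          y#- zero    1≤n _   = #-congˡ (sym -0#≈0#) (y#+ 0 1≤n)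
          y#- (suc k) _   k<n = y# ℤ.-[1+ k ] (ℤ.neg-mono-≤ (ℤ.+≤+ k<n)) ℤ.-<+

        binom[y]#0 : binom y n # 0#
        binom[y]#0 = binom#0 y n y#+

        binom[y-n+k]#0 : ∀ k → k ℕ.≤ n → binom (y - fromℕ n + fromℕ k) k # 0#
        binom[y-n+k]#0 k k≤n = binom#0 (y - fromℕ n + fromℕ k) k λ i i<k →
          let m = n ℕ.∸ k
              m+k≡n = ℕ.m∸n+n≡m k≤n
          in #-congˡ
            (begin
              fromℕ (m ℕ.+ i) + (- fromℕ n + fromℕ k)
                ≈⟨ +-cong (trans (×-homo-+ 1# m i) (+-comm (fromℕ m) (fromℕ i)))
                          (+-congʳ (-‿cong (trans (reflexive (cong fromℕ (≡.sym m+k≡n)))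
                                                  (×-homo-+ 1# m k)))) ⟩
              (fromℕ i + fromℕ m) + (- (fromℕ m + fromℕ k) + fromℕ k)
                ≈⟨ +-congˡ (+-congʳ (-‿+-comm (fromℕ m) (fromℕ k))) ⟨
              (fromℕ i + fromℕ m) + ((- fromℕ m - fromℕ k) + fromℕ k)
                ≈⟨ +-congˡ (+-assoc (- fromℕ m) (- fromℕ k) (fromℕ k)) ⟩
              (fromℕ i + fromℕ m) + (- fromℕ m + (- fromℕ k + fromℕ k))
                ≈⟨ +-congˡ (trans (+-congˡ (-‿inverseˡ (fromℕ k))) (+-identityʳ (- fromℕ m))) ⟩
              (fromℕ i + fromℕ m) - fromℕ m
                ≈⟨ +-assoc (fromℕ i) (fromℕ m) (- fromℕ m) ⟩
              fromℕ i + (fromℕ m - fromℕ m)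
                ≈⟨ trans (+-congˡ (-‿inverseʳ (fromℕ m))) (+-identityʳ (fromℕ i)) ⟩
              fromℕ i ∎)
            (#-congʳ (sym (+-assoc y (- fromℕ n) (fromℕ k)))
              (#-translate (- fromℕ n + fromℕ k)
                (y#+ (m ℕ.+ i) (subst (m ℕ.+ i ℕ.<_) m+k≡n (ℕ.+-monoʳ-< m i<k)))))

        [y+k-1][y+k]#0 : 2 ℕ.≤ n → ∀ k → k ℕ.≤ n →
                         (y + fromℕ k - 1#) * (y + fromℕ k) # 0#
        [y+k-1][y+k]#0 2≤n k k≤n = x#0y#0→xy#0 (a#b⇒a-b#0 (y+k#1 k k≤n)) (a#-b⇒a+b#0 (y#- k 1≤n k≤n))
          where
          1≤n : 1 ℕ.≤ n
          1≤n = ℕ.≤-trans (ℕ.n≤1+n 1) 2≤n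
          y+k#1 : ∀ k → k ℕ.≤ n → y + fromℕ k # 1#
          y+k#1 zero    _   = #-congˡ (+-identityʳ 1#) (#-congʳ (sym (+-identityʳ y)) (y#+ 1 2≤n))
          y+k#1 (suc j) j<n = #-congˡ
            (begin
              - fromℕ j + (1# + fromℕ j) ≈⟨ +-congˡ (+-comm 1# (fromℕ j)) ⟩
              - fromℕ j + (fromℕ j + 1#) ≈⟨ +-assoc (- fromℕ j) (fromℕ j) 1# ⟨
              - fromℕ j + fromℕ j + 1#   ≈⟨ +-congʳ (-‿inverseˡ (fromℕ j)) ⟩
              0# + 1#                    ≈⟨ +-identityˡ 1# ⟩
              1#                         ∎)
            (#-translate (fromℕ (suc j)) (y#- j 1≤n (ℕ.<⇒≤ j<n)))

open HeytingField ℂ-heytingField public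
  using (_≈_; _#_; _+_; _*_; -_; _-_; 0#; 1#)
open Identities ℂ-heytingField public
  using (_^_; sum-syntax; sum⁺-syntax; fromℕ; fromℤ; _/_⟨_⟩; H; falling; *-#0;
         module CharacteristicZero)

opaque
  unfolding ComplexField._#_

  ℂ-characteristicZero : ∀ n → fromℕ (suc n) # 0#
  ℂ-characteristicZero n = inj₁ (½ , ℚ.positive⁻¹ ½ , 0 , λ m _ → large n m)
    where
    nonneg : ∀ n m → 0ℚ ℚ.≤ seq (re (fromℕ n)) m
    nonneg zero    m = ℚ.≤-refl
    nonneg (suc n) m = subst (ℚ._≤ 1ℚ ℚ.+ seq (re (fromℕ n)) m) (ℚ.+-identityʳ 0ℚ)
      (ℚ.+-mono-≤ (ℚ.<⇒≤ 0<1) (nonneg n m))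
    large : ∀ n m → ½ ℚ.< ℚ.∣ seq (re (fromℕ (suc n))) m ℚ.- 0ℚ ∣
    large n m = ℚ.<-≤-trans (half< 0<1) (subst (1ℚ ℚ.≤_)
      (≡.sym (≡.trans (cong ℚ.∣_∣ (ℚ.+-identityʳ (seq (re (fromℕ (suc n))) m)))
                      (ℚ.0≤p⇒∣p∣≡p (nonneg (suc n) m))))
      (subst (ℚ._≤ 1ℚ ℚ.+ seq (re (fromℕ n)) m) (ℚ.+-identityʳ 1ℚ)
        (ℚ.+-monoʳ-≤ 1ℚ (nonneg n m))))

open CharacteristicZero ℂ-characteristicZero public

{-# OPTIONS --safe #-}

-- Let tₖ be the coefficient of H_k^⟨2⟩(x) on the left. Then t₀ = 1 and tₖ₊₁/tₖ is rational in k;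
-- the terms are Gosper-summable, and their sum over 0 ≤ k ≤ n vanishes. Summation by parts
-- therefore turns the left-hand side into Σⱼ rⱼ/(x + j)² with explicit rⱼ. Up to scaling, the rⱼ
-- are the residues of f(x) = Πᵢ (x + bᵢ)/(x + i), where b₁ = 1 - y + n y and bᵢ = i - y for
-- 2 ≤ i ≤ n. Since f(x) = 1 + Σⱼ rⱼ/(x + j), the sum is -f′(x), and the logarithmic derivative
-- of f produces the harmonic numbers on the right.
module Submission where

open import Algebra.Apartness.Bundles using (HeytingCommutativeRing; HeytingField)
import Algebra.Apartness.Properties.HeytingCommutativeRing as HeytingProperties
open import Algebra.Bundles using (CommutativeRing)
import Algebra.Solver.Ring as RingSolver
open import Algebra.Solver.Ring.AlmostCommutativeRing using (fromCommutativeRing; _-Raw-AlmostCommutative⟶_)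
open import Data.Fin.Base as Fin using (Fin; toℕ)
open import Data.Fin.Properties using (toℕ≤pred[n]; toℕ<n)
open import Data.Integer.Base as ℤ using (ℤ)
import Data.Integer.Properties as ℤ
open import Data.Maybe.Base using (Maybe; just; nothing)
open import Data.Nat.Base as ℕ using (ℕ; zero; suc; _!)
import Data.Nat.Properties as ℕ
open import Data.Nat.Properties using (≤-trans)
open import Data.Product.Base using (proj₁; proj₂)
open import Data.Sign.Base as Sign using ()
open import Defs using (module Identities)
open import Relation.Binary.PropositionalEquality as ≡ using (_≡_; cong)
open import Relation.Nullary using (¬_; yes; no; contradiction)

-- The exceptional root comes from Gosper's algorithm: up to a constant, the partial sum up to k is
-- tₖ times (n - k)(k + y - 1) and one further linear factor (n - 1) y - k. That factor is b₁ - (k +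
-- 1), while the closed form of tₖ supplies the factors bᵢ - (k + 1) with i ≥ 2. If b₁ were 1 - y,
-- then f would be a plain quotient of binomials; its shift by n y accounts both for the quotient (1
-- + x - y + n y) / (1 + x - y) on the right and for the fraction in braces. No calculus is
-- involved: the expansion of f and the formula for -f′ are algebraic identities, each proved by
-- induction on the number of factors over a commutative ring in which the needed inverses are given
-- as sequences. Divisions in the statement carry apartness proofs that change from term to term.
-- They are traded for such sequences, and the identity is proved after multiplication by n (n - 1)
-- y (y - 1) and the falling factorial of y of length n, which are cancelled at the end.

-- Ring solving with integer coefficients

module IntegerCoefficients {c ℓ} (R : CommutativeRing c ℓ) where

  open CommutativeRing R
  open import Algebra.Properties.Ring ring
    using (-‿involutive; -0#≈0#; -‿+-comm; -‿distribˡ-*; -‿distribʳ-*)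
  open import Algebra.Properties.Semiring.Mult.TCOptimised semiring
    using (1+×; ×-homo-+; ×1-homo-*) renaming (_×_ to _·_)
  open import Relation.Binary.Reasoning.Setoid setoid

  private

    -- For this form of multiples `1 · 1#` reduces to `1#`, so that `:0` and `:1` denote `0#` and
    -- `1#` definitionally.
    fromℤ : ℤ → Carrier
    fromℤ (ℤ.+ n)    = n · 1#
    fromℤ ℤ.-[1+ n ] = - (suc n · 1#)

    fromℤ-⊖ : ∀ m n → fromℤ (m ℤ.⊖ n) ≈ m · 1# - n · 1#
    fromℤ-⊖ m zero = sym (trans (+-congˡ -0#≈0#) (+-identityʳ (m · 1#)))
    fromℤ-⊖ zero (suc n) = sym (+-identityˡ (- (suc n · 1#)))
    fromℤ-⊖ (suc m) (suc n) = begin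
      fromℤ (suc m ℤ.⊖ suc n)             ≡⟨ cong fromℤ (ℤ.[1+m]⊖[1+n]≡m⊖n m n) ⟩
      fromℤ (m ℤ.⊖ n)                     ≈⟨ fromℤ-⊖ m n ⟩
      m · 1# - n · 1#                     ≈⟨ +-congʳ (+-identityˡ (m · 1#)) ⟨
      0# + m · 1# - n · 1#                ≈⟨ +-congʳ (+-congʳ (-‿inverseʳ 1#)) ⟨
      1# - 1# + m · 1# - n · 1#           ≈⟨ +-congʳ (+-assoc 1# (- 1#) (m · 1#)) ⟩
      1# + (- 1# + m · 1#) - n · 1#       ≈⟨ +-congʳ (+-congˡ (+-comm (- 1#) (m · 1#))) ⟩
      1# + (m · 1# - 1#) - n · 1#         ≈⟨ +-congʳ (+-assoc 1# (m · 1#) (- 1#)) ⟨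
      1# + m · 1# - 1# - n · 1#           ≈⟨ +-assoc (1# + m · 1#) (- 1#) (- (n · 1#)) ⟩
      1# + m · 1# + (- 1# - n · 1#)       ≈⟨ +-congˡ (-‿+-comm 1# (n · 1#)) ⟩
      1# + m · 1# - (1# + n · 1#)         ≈⟨ +-cong (1+× m 1#) (-‿cong (1+× n 1#)) ⟨
      suc m · 1# - suc n · 1#             ∎

    fromℤ-+ : ∀ i j → fromℤ (i ℤ.+ j) ≈ fromℤ i + fromℤ j
    fromℤ-+ (ℤ.+ m)    (ℤ.+ n)    = ×-homo-+ 1# m n
    fromℤ-+ (ℤ.+ m)    ℤ.-[1+ n ] = fromℤ-⊖ m (suc n)
    fromℤ-+ ℤ.-[1+ m ] (ℤ.+ n)    = trans (fromℤ-⊖ n (suc m)) (+-comm _ _)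
    fromℤ-+ ℤ.-[1+ m ] ℤ.-[1+ n ] = begin
      - (suc (suc (m ℕ.+ n)) · 1#)     ≡⟨ cong (λ k → - (suc k · 1#)) (ℕ.+-suc m n) ⟨
      - ((suc m ℕ.+ suc n) · 1#)       ≈⟨ -‿cong (×-homo-+ 1# (suc m) (suc n)) ⟩
      - (suc m · 1# + suc n · 1#)      ≈⟨ -‿+-comm (suc m · 1#) (suc n · 1#) ⟨
      - (suc m · 1#) - suc n · 1#      ∎

    fromℤ-◃ : ∀ n → fromℤ (Sign.- ℤ.◃ n) ≈ - (n · 1#)
    fromℤ-◃ zero    = sym -0#≈0#
    fromℤ-◃ (suc n) = refl

    fromℤ-* : ∀ i j → fromℤ (i ℤ.* j) ≈ fromℤ i * fromℤ j
    fromℤ-* (ℤ.+ m)    (ℤ.+ n)    =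
      trans (reflexive (cong fromℤ (ℤ.+◃n≡+n (m ℕ.* n)))) (×1-homo-* m n)
    fromℤ-* (ℤ.+ m)    ℤ.-[1+ n ] = trans (fromℤ-◃ (m ℕ.* suc n))
      (trans (-‿cong (×1-homo-* m (suc n))) (-‿distribʳ-* (m · 1#) (suc n · 1#)))
    fromℤ-* ℤ.-[1+ m ] (ℤ.+ n)    = trans (fromℤ-◃ (suc m ℕ.* n))
      (trans (-‿cong (×1-homo-* (suc m) n)) (-‿distribˡ-* (suc m · 1#) (n · 1#)))
    fromℤ-* ℤ.-[1+ m ] ℤ.-[1+ n ] = begin
      (suc m ℕ.* suc n) · 1#               ≈⟨ ×1-homo-* (suc m) (suc n) ⟩
      suc m · 1# * (suc n · 1#)            ≈⟨ -‿involutive _ ⟨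
      - (- (suc m · 1# * (suc n · 1#)))    ≈⟨ -‿cong (-‿distribˡ-* (suc m · 1#) (suc n · 1#)) ⟩
      - (- (suc m · 1#) * (suc n · 1#))    ≈⟨ -‿distribʳ-* (- (suc m · 1#)) (suc n · 1#) ⟩
      - (suc m · 1#) * - (suc n · 1#)      ∎

    fromℤ-neg : ∀ i → fromℤ (ℤ.- i) ≈ - fromℤ i
    fromℤ-neg (ℤ.+ zero)  = sym -0#≈0#
    fromℤ-neg (ℤ.+ suc n) = refl
    fromℤ-neg ℤ.-[1+ n ]  = sym (-‿involutive (suc n · 1#))

    morphism : ℤ.+-*-rawRing -Raw-AlmostCommutative⟶ fromCommutativeRing R
    morphism = record
      { ⟦_⟧    = fromℤ
      ; +-homo = fromℤ-+
      ; *-homo = fromℤ-*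
      ; -‿homo = fromℤ-neg
      ; 0-homo = refl
      ; 1-homo = refl
      }

    -- Distinct integers may coincide in `R`, so a negative answer carries no information; the
    -- solver asks only for positive ones.
    _≟_ : ∀ i j → Maybe (fromℤ i ≈ fromℤ j)
    i ≟ j with i ℤ.≟ j
    ... | yes ≡.refl = just refl
    ... | no _       = nothing

  open RingSolver ℤ.+-*-rawRing (fromCommutativeRing R) morphism _≟_ public

  :0 :1 : ∀ {n} → Polynomial n
  :0 = con ℤ.0ℤ
  :1 = con ℤ.1ℤ

-- Finite sums and products; summation by parts

module PartialFractions {c ℓ} (R : CommutativeRing c ℓ) where

  open CommutativeRing R
  open IntegerCoefficients R
  open import Relation.Binary.Reasoning.Setoid setoid

  sum : ℕ → (ℕ → Carrier) → Carrier
  sum zero    f = 0#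
  sum (suc n) f = sum n f + f n

  product : ℕ → (ℕ → Carrier) → Carrier
  product zero    f = 1#
  product (suc n) f = product n f * f n

  sum-cong : ∀ n {f g} → (∀ {i} → i ℕ.< n → f i ≈ g i) → sum n f ≈ sum n g
  sum-cong zero    f≈g = refl
  sum-cong (suc n) f≈g =
    +-cong (sum-cong n λ i<n → f≈g (ℕ.m<n⇒m<1+n i<n)) (f≈g ℕ.≤-refl)

  product-cong : ∀ n {f g} → (∀ {i} → i ℕ.< n → f i ≈ g i) → product n f ≈ product n g
  product-cong zero    f≈g = refl
  product-cong (suc n) f≈g =
    *-cong (product-cong n λ i<n → f≈g (ℕ.m<n⇒m<1+n i<n)) (f≈g ℕ.≤-refl)

  sum-linear : ∀ n a b f g → sum n (λ i → a * f i + b * g i) ≈ a * sum n f + b * sum n g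
  sum-linear zero    a b f g = solve 2 (λ a b → :0 := a :* :0 :+ b :* :0) refl a b
  sum-linear (suc n) a b f g = begin
    sum n (λ i → a * f i + b * g i) + (a * f n + b * g n)
      ≈⟨ +-congʳ (sum-linear n a b f g) ⟩
    a * sum n f + b * sum n g + (a * f n + b * g n)
      ≈⟨ solve 6 (λ a b F G f g → a :* F :+ b :* G :+ (a :* f :+ b :* g)
                                  := a :* (F :+ f) :+ b :* (G :+ g))
           refl a b (sum n f) (sum n g) (f n) (g n) ⟩
    a * (sum n f + f n) + b * (sum n g + g n) ∎

  *-sum : ∀ n a f → sum n (λ i → a * f i) ≈ a * sum n f
  *-sum zero    a f = sym (zeroʳ a)
  *-sum (suc n) a f = trans (+-congʳ (*-sum n a f)) (sym (distribˡ a (sum n f) (f n)))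

  product-* : ∀ n f g → product n (λ i → f i * g i) ≈ product n f * product n g
  product-* zero    f g = sym (*-identityˡ 1#)
  product-* (suc n) f g = trans (*-congʳ (product-* n f g))
    (solve 4 (λ F G f g → F :* G :* (f :* g) := F :* f :* (G :* g)) refl
      (product n f) (product n g) (f n) (g n))

  product-head : ∀ n f → product (suc n) f ≈ f 0 * product n (λ i → f (suc i))
  product-head zero    f = trans (*-identityˡ (f 0)) (sym (*-identityʳ (f 0)))
  product-head (suc n) f = trans (*-congʳ (product-head n f)) (*-assoc _ _ _)

  sum-head : ∀ n f → sum (suc n) f ≈ f 0 + sum n (λ i → f (suc i))
  sum-head zero    f = +-comm 0# (f 0)
  sum-head (suc n) f = trans (+-congʳ (sum-head n f)) (+-assoc _ _ _)

  -- `h j` occurs in `sum k h` exactly when k > j, so its total coefficient is the tail of `t`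
  -- beyond j, which is the full sum minus `sum (suc j) t`.
  summation-by-parts : ∀ n (t h : ℕ → Carrier) →
    sum (suc n) (λ k → t k * sum k h)
      ≈ sum (suc n) t * sum n h - sum n (λ j → h j * sum (suc j) t)
  summation-by-parts zero    t h = solve 1
    (λ t → :0 :+ t :* :0 := (:0 :+ t) :* :0 :- :0) refl (t 0)
  summation-by-parts (suc n) t h = begin
    sum (suc n) (λ k → t k * sum k h) + t (suc n) * (sum n h + h n)
      ≈⟨ +-congʳ (summation-by-parts n t h) ⟩
    T * sum n h - S + t (suc n) * (sum n h + h n)
      ≈⟨ solve 5 (λ T H h S t → T :* H :- S :+ t :* (H :+ h)
                                := (T :+ t) :* (H :+ h) :- (S :+ h :* T))
           refl T (sum n h) (h n) S (t (suc n)) ⟩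
    (T + t (suc n)) * (sum n h + h n) - (S + h n * T) ∎
    where
    T = sum (suc n) t
    S = sum n (λ j → h j * sum (suc j) t)

  -- Partial fractions of a product of (x + b i) / (x + a i), and their derivative

  module _ (a b : ℕ → Carrier) (ε : ℕ → ℕ → Carrier)
           (ε-diagonal : ∀ j → ε j j ≈ 1#)
           (ε-inverse : ∀ i j → ¬ i ≡ j → (a i - a j) * ε i j ≈ 1#) where

    -- For j < n this is the residue at - a j of the product of the first `n` factors: since `ε j j`
    -- is 1, the factor i = j is just `b j - a j`. For j = n, one past the last factor, it is
    -- instead the value of that product at x = - a n.
    residue : ℕ → ℕ → Carrier
    residue n j = product n (λ i → (b i - a j) * ε i j)

    private

      unique : ∀ {d u v} → d * u ≈ 1# → d * v ≈ 1# → u ≈ v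
      unique {d} {u} {v} du≈1 dv≈1 = begin
        u             ≈⟨ *-identityˡ u ⟨
        1# * u        ≈⟨ *-congʳ dv≈1 ⟨
        d * v * u     ≈⟨ solve 3 (λ d u v → d :* v :* u := v :* (d :* u)) refl d u v ⟩
        v * (d * u)   ≈⟨ *-congˡ du≈1 ⟩
        v * 1#        ≈⟨ *-identityʳ v ⟩
        v             ∎

      ε-antisym : ∀ i j → ¬ i ≡ j → ε j i ≈ - ε i j
      ε-antisym i j i≢j = unique (ε-inverse j i (λ eq → i≢j (≡.sym eq))) (begin
        (a j - a i) * - ε i j
          ≈⟨ solve 3 (λ a a′ e → (a′ :- a) :* (:- e) := (a :- a′) :* e) refl (a i) (a j) (ε i j) ⟩
        (a i - a j) * ε i j ≈⟨ ε-inverse i j i≢j ⟩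
        1# ∎)

      residue-last : ∀ n → residue (suc n) n ≈ (b n - a n) * residue n n
      residue-last n = trans (*-congˡ (trans (*-congˡ (ε-diagonal n)) (*-identityʳ _))) (*-comm _ _)

      -- The first resolvent identity: two inverses differ by their product times `a′ - a`, and `ε`
      -- divides by that factor.
      resolvent : ∀ x {a a′ ε w u} → (x + a) * w ≈ 1# → (x + a′) * u ≈ 1# → (a′ - a) * ε ≈ 1# →
                  ε * (w - u) ≈ w * u
      resolvent x {a} {a′} {ε} {w} {u} w⁻¹ u⁻¹ ε⁻¹ = begin
        ε * (w - u)
          ≈⟨ solve 3 (λ e w u → e :* (w :- u) := e :* (:1 :* w :- :1 :* u)) refl ε w u ⟩
        ε * (1# * w - 1# * u)
          ≈⟨ *-congˡ (+-cong (*-congʳ u⁻¹) (-‿cong (*-congʳ w⁻¹))) ⟨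
        ε * ((x + a′) * u * w - (x + a) * w * u)
          ≈⟨ solve 6 (λ x a a′ e w u → e :* ((x :+ a′) :* u :* w :- (x :+ a) :* w :* u)
                                        := ((a′ :- a) :* e) :* (w :* u)) refl x a a′ ε w u ⟩
        (a′ - a) * ε * (w * u) ≈⟨ *-congʳ ε⁻¹ ⟩
        1# * (w * u)           ≈⟨ *-identityˡ (w * u) ⟩
        w * u                  ∎

      shift : ∀ x {a w} b → (x + a) * w ≈ 1# → (b - a) * w ≈ (x + b) * w - 1#
      shift x {a} {w} b w⁻¹ = begin
        (b - a) * w
          ≈⟨ solve 4 (λ x a b w → (b :- a) :* w := (x :+ b) :* w :- (x :+ a) :* w) refl x a b w ⟩
        (x + b) * w - (x + a) * w ≈⟨ +-congˡ (-‿cong w⁻¹) ⟩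
        (x + b) * w - 1#          ∎

    -- Induction on the number of factors. The corrections that `term` leaves at the old poles add
    -- up to `- (d * u) * E`; the new residue `d * (1# + E)` cancels them and leaves `d * u`, which
    -- is the new factor minus 1.
    partial-fractions : ∀ n x w → (∀ {i} → i ℕ.< n → (x + a i) * w i ≈ 1#) →
      product n (λ i → (x + b i) * w i) ≈ 1# + sum n (λ j → residue n j * w j)

    -- The expansion of the first `n` factors evaluated at x = - a n, where `ε i n` inverts x + a i.
    -- It and `partial-fractions` are mutually recursive: it uses the expansion at `n`, and the
    -- expansion at `suc n` uses it at `n`.
    residue-value : ∀ n → residue n n ≈ 1# + sum n (λ j → residue n j * ε j n)

    private

      -- Multiplying in the factor (x + b n) / (x + a n) couples the poles at - a j and - a n
      -- through `w j * w n`, which `resolvent` relates to `w j - w n`. The last summand is the part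
      -- that belongs to the new pole alone.
      term : ∀ x n w → (∀ {i} → i ℕ.< suc n → (x + a i) * w i ≈ 1#) → ∀ {j} → j ℕ.< n →
        residue (suc n) j * w j ≈
          (x + b n) * w n * (residue n j * w j) + (- ((b n - a n) * w n)) * (residue n j * ε j n)
      term x n w w⁻¹ {j} j<n = begin
        r * ((b n - a j) * e) * w j
          ≈⟨ solve 4 (λ r c e w → r :* (c :* e) :* w
              := r :* (e :* (c :* w))) refl r (b n - a j) e (w j) ⟩
        r * (e * ((b n - a j) * w j))
          ≈⟨ *-congˡ (*-congˡ (shift x (b n) wⱼ)) ⟩
        r * (e * ((x + b n) * w j - 1#))
          -- Adding and subtracting `(x + b n) * w n` exposes the difference to which `resolvent`
          -- applies.
          ≈⟨ solve 5 (λ r e X w u → r :* (e :* (X :* w :- :1))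
                := r :* (X :* (e :* (w :- u)) :+ e :* (X :* u :- :1)))
                    refl r e (x + b n) (w j) (w n) ⟩
        r * ((x + b n) * (e * (w j - w n)) + e * ((x + b n) * w n - 1#))
          ≈⟨ *-congˡ (+-cong (*-congˡ (resolvent x wⱼ wₙ (ε-inverse n j n≢j)))
              (*-congˡ (sym (shift x (b n) wₙ)))) ⟩
        r * ((x + b n) * (w j * w n) + e * ((b n - a n) * w n))
          ≈⟨ solve 6 (λ r X w u e c → r :* (X :* (w :* u) :+ e :* (c :* u))
                := X :* u :* (r :* w) :+ (:- (c :* u)) :* (r :* (:- e)))
                    refl r (x + b n) (w j) (w n) e (b n - a n) ⟩
        (x + b n) * w n * (r * w j) + (- ((b n - a n) * w n)) * (r * - e)
          ≈⟨ +-congˡ (*-congˡ (*-congˡ (ε-antisym n j n≢j))) ⟨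
        (x + b n) * w n * (r * w j) + (- ((b n - a n) * w n)) * (r * ε j n) ∎
        where
        r = residue n j
        e = ε n j
        n≢j : ¬ n ≡ j
        n≢j eq = ℕ.<-irrefl (≡.sym eq) j<n
        wⱼ = w⁻¹ (ℕ.m<n⇒m<1+n j<n)
        wₙ = w⁻¹ ℕ.≤-refl

    residue-value n = trans
      (product-cong n λ {i} _ → *-congʳ (+-comm (b i) (- a n)))
      (partial-fractions n (- a n) (λ i → ε i n) λ {i} i<n →
        trans (*-congʳ (+-comm (- a n) (a i))) (ε-inverse i n (ℕ.<⇒≢ i<n)))

    partial-fractions zero    x w w⁻¹ = sym (+-identityʳ 1#)
    partial-fractions (suc n) x w w⁻¹ = sym (begin
      1# + (sum n (λ j → residue (suc n) j * w j) + residue (suc n) n * w n)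
        ≈⟨ +-congˡ (+-cong (trans (sum-cong n (term x n w w⁻¹)) (sum-linear n _ _ _ _))
                           (*-congʳ (trans (residue-last n) (*-congˡ (residue-value n))))) ⟩
      1# + (X * u * S + (- (d * u)) * E + d * (1# + E) * u)
        ≈⟨ solve 5 (λ X u S E c → :1 :+ (X :* u :* S :+ (:- (c :* u)) :* E :+ c :* (:1 :+ E) :* u)
             := :1 :+ X :* u :* S :+ c :* u) refl X u S E d ⟩
      1# + X * u * S + d * u
        ≈⟨ +-congˡ (shift x (b n) (w⁻¹ ℕ.≤-refl)) ⟩
      1# + X * u * S + (X * u - 1#)
        ≈⟨ solve 3 (λ X u S → :1 :+ X :* u :* S :+ (X :* u :- :1)
            := (:1 :+ S) :* (X :* u)) refl X u S ⟩
      (1# + S) * (X * u)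
        ≈⟨ *-congʳ (partial-fractions n x w (λ i<n → w⁻¹ (ℕ.m<n⇒m<1+n i<n))) ⟨
      product n (λ i → (x + b i) * w i) * (X * u) ∎)
      where
      X = x + b n
      u = w n
      d = b n - a n
      S = sum n (λ j → residue n j * w j)
      E = sum n (λ j → residue n j * ε j n)

    private

      -- After `term` is multiplied by `w j`, its correction contains a product of both inverses
      -- again; a second use of `resolvent` reduces it to first-order terms. The coefficients `1#`
      -- and `- 1#` fit the shape of `sum-linear`.
      term² : ∀ x n w → (∀ {i} → i ℕ.< suc n → (x + a i) * w i ≈ 1#) → ∀ {j} → j ℕ.< n →
        residue (suc n) j * (w j * w j) ≈
          (x + b n) * w n * (residue n j * (w j * w j))
          + (b n - a n) * w n * w n * (1# * (residue n j * w j) + (- 1#) * (residue n j * ε j n))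
      term² x n w w⁻¹ {j} j<n = begin
        residue (suc n) j * (w j * w j)
          ≈⟨ *-assoc _ (w j) (w j) ⟨
        residue (suc n) j * w j * w j
          ≈⟨ *-congʳ (term x n w w⁻¹ j<n) ⟩
        (X * u * (r * w j) + (- (d * u)) * (r * ε j n)) * w j
          ≈⟨ *-congʳ (+-congˡ (*-congˡ (*-congˡ (ε-antisym n j n≢j)))) ⟩
        (X * u * (r * w j) + (- (d * u)) * (r * - e)) * w j
          ≈⟨ solve 6 (λ X u r w d e → (X :* u :* (r :* w) :+ (:- (d :* u)) :* (r :* (:- e))) :* w
               := X :* u :* (r :* (w :* w)) :+ d :* u :* r :* (e :* u :+ e :* (w :- u)))
               refl X u r (w j) d e ⟩
        X * u * (r * (w j * w j)) + d * u * r * (e * u + e * (w j - u))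
          ≈⟨ +-congˡ
              (*-congˡ (+-congˡ (resolvent x (w⁻¹ (ℕ.m<n⇒m<1+n j<n)) (w⁻¹ ℕ.≤-refl) (ε-inverse n j n≢j)))) ⟩
        X * u * (r * (w j * w j)) + d * u * r * (e * u + w j * u)
          ≈⟨ +-congˡ (solve 5 (λ u r w d e → d :* u :* r :* (e :* u :+ w :* u)
               := d :* u :* u :* (:1 :* (r :* w) :+ (:- :1) :* (r :* (:- e))))
               refl u r (w j) d e) ⟩
        X * u * (r * (w j * w j)) + d * u * u * (1# * (r * w j) + (- 1#) * (r * - e))
          ≈⟨ +-congˡ (*-congˡ (+-congˡ (*-congˡ (*-congˡ (ε-antisym n j n≢j))))) ⟨
        X * u * (r * (w j * w j)) + d * u * u * (1# * (r * w j) + (- 1#) * (r * ε j n)) ∎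
        where
        X = x + b n
        u = w n
        d = b n - a n
        r = residue n j
        e = ε n j
        n≢j : ¬ n ≡ j
        n≢j eq = ℕ.<-irrefl (≡.sym eq) j<n

    -- Minus the derivative in x of partial-fractions; the right-hand side is the
    -- logarithmic derivative of the product.
    partial-fractions′ : ∀ n x (w v : ℕ → Carrier) →
      (∀ {i} → i ℕ.< n → (x + a i) * w i ≈ 1#) → (∀ {i} → i ℕ.< n → (x + b i) * v i ≈ 1#) →
      sum n (λ j → residue n j * (w j * w j))
        ≈ product n (λ i → (x + b i) * w i) * sum n (λ i → w i - v i)
    partial-fractions′ zero    x w v w⁻¹ v⁻¹ = sym (zeroʳ 1#)
    partial-fractions′ (suc n) x w v w⁻¹ v⁻¹ = begin
      sum n (λ j → residue (suc n) j * (w j * w j)) + residue (suc n) n * (u * u)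
        ≈⟨ +-cong (trans (sum-cong n (term² x n w w⁻¹))
                    (trans (sum-linear n _ _ _ _) (+-congˡ (*-congˡ (sum-linear n _ _ _ _)))))
                  (*-congʳ (trans (residue-last n) (*-congˡ (residue-value n)))) ⟩
      X * u * S² + d * u * u * (1# * S + (- 1#) * E) + d * (1# + E) * (u * u)
        ≈⟨ solve 6 (λ X u S² d S E → X :* u :* S² :+ d :* u :* u :* (:1 :* S :+ (:- :1) :* E)
                                        :+ d :* (:1 :+ E) :* (u :* u)
             := X :* u :* S² :+ (:1 :+ S) :* u :* (d :* u)) refl X u S² d S E ⟩
      X * u * S² + (1# + S) * u * (d * u)
        ≈⟨ +-cong (*-congˡ (partial-fractions′ n x w v (λ i<n → w⁻¹ (ℕ.m<n⇒m<1+n i<n)) (λ i<n →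
            v⁻¹ (ℕ.m<n⇒m<1+n i<n))))
                  (*-cong (*-congʳ (sym (partial-fractions n x w (λ i<n → w⁻¹ (ℕ.m<n⇒m<1+n i<n)))))
                          (shift x (b n) (w⁻¹ ℕ.≤-refl))) ⟩
      X * u * (F * L) + F * u * (X * u - 1#)
        -- Writing 1 as `X * v n` turns the increment into the product times `u - v n`, the
        -- logarithmic derivative of the new factor up to sign.
        ≈⟨ +-congˡ (*-congˡ (+-congˡ (-‿cong (v⁻¹ ℕ.≤-refl)))) ⟨
      X * u * (F * L) + F * u * (X * u - X * v n)
        ≈⟨ solve 5 (λ X u F L v → X :* u :* (F :* L) :+ F :* u :* (X :* u :- X :* v)
             := F :* (X :* u) :* (L :+ (u :- v))) refl X u F L (v n) ⟩
      F * (X * u) * (L + (u - v n)) ∎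
      where
      X = x + b n
      u = w n
      d = b n - a n
      F = product n (λ i → (x + b i) * w i)
      L = sum n (λ i → w i - v i)
      S = sum n (λ j → residue n j * w j)
      S² = sum n (λ j → residue n j * (w j * w j))
      E = sum n (λ j → residue n j * ε j n)

-- Falling factorials and reciprocals in a Heyting field of characteristic zero

module Hypergeometric {c ℓ₁ ℓ₂} (K : HeytingField c ℓ₁ ℓ₂)
  (fromℕ#0 : ∀ n → HeytingField._#_ K (Identities.fromℕ K (suc n)) (HeytingField.0# K)) where

  open HeytingField K
  open Identities K using (fromℕ; falling; _^_)

  R : CommutativeRing c ℓ₁
  R = HeytingCommutativeRing.commutativeRing heytingCommutativeRing

  open CommutativeRing R using (semiring)
  open HeytingProperties heytingCommutativeRing using (x-0≈x)
  open import Algebra.Properties.Semiring.Mult semiring using (×-homo-+; ×1-homo-*)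
  open IntegerCoefficients R
  open PartialFractions R
  open import Relation.Binary.Reasoning.Setoid setoid

  recip : ∀ {a} → a # 0# → Carrier
  recip a#0 = proj₁ (#⇒invertible a#0)

  *-recip : ∀ {a} (a#0 : a # 0#) → a * recip a#0 ≈ 1#
  *-recip {a} a#0 = trans (*-congʳ (sym (x-0≈x a))) (proj₂ (proj₂ (#⇒invertible a#0)))

  *-cancelʳ : ∀ {d a b} → d # 0# → a * d ≈ b * d → a ≈ b
  *-cancelʳ {d} {a} {b} d#0 ad≈bd = begin
    a                      ≈⟨ *-identityʳ a ⟨
    a * 1#                 ≈⟨ *-congˡ (*-recip d#0) ⟨
    a * (d * recip d#0)    ≈⟨ *-assoc a d _ ⟨
    a * d * recip d#0      ≈⟨ *-congʳ ad≈bd ⟩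
    b * d * recip d#0      ≈⟨ *-assoc b d _ ⟩
    b * (d * recip d#0)    ≈⟨ *-congˡ (*-recip d#0) ⟩
    b * 1#                 ≈⟨ *-identityʳ b ⟩
    b                      ∎

  signs-cancel : ∀ n → (- 1#) ^ n * (- 1#) ^ n ≈ 1#
  signs-cancel zero    = *-identityˡ 1#
  signs-cancel (suc n) = trans
    (solve 1 (λ s → (:- :1) :* s :* ((:- :1) :* s) := s :* s) refl ((- 1#) ^ n))
    (signs-cancel n)

  falling-cong : ∀ {u v} k → u ≈ v → falling u k ≈ falling v k
  falling-cong zero    u≈v = refl
  falling-cong (suc k) u≈v = *-cong (falling-cong k u≈v) (+-congʳ u≈v)

  falling-suc : ∀ u k → falling (u + 1#) (suc k) ≈ (u + 1#) * falling u k
  falling-suc u zero = solve 1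
    (λ u → :1 :* (u :+ :1 :- :0) := (u :+ :1) :* :1) refl u
  falling-suc u (suc k) = trans (*-congʳ (falling-suc u k))
    (solve 3 (λ u k f → (u :+ :1) :* f :* (u :+ :1 :- (:1 :+ k))
      := (u :+ :1) :* (f :* (u :- k))) refl u (fromℕ k) (falling u k))

  fromℕ-! : ∀ k → fromℕ (suc k !) ≈ fromℕ (suc k) * fromℕ (k !)
  fromℕ-! k = ×1-homo-* (suc k) (k !)

  falling-! : ∀ k → falling (fromℕ k) k ≈ fromℕ (k !)
  falling-! zero    = sym (+-identityʳ 1#)
  falling-! (suc k) = begin
    falling (1# + fromℕ k) (suc k)     ≈⟨ falling-cong (suc k) (+-comm 1# (fromℕ k)) ⟩
    falling (fromℕ k + 1#) (suc k)     ≈⟨ falling-suc (fromℕ k) k ⟩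
    (fromℕ k + 1#) * falling (fromℕ k) k ≈⟨ *-cong (+-comm (fromℕ k) 1#) (falling-! k) ⟩
    fromℕ (suc k) * fromℕ (k !)        ≈⟨ fromℕ-! k ⟨
    fromℕ (suc k !)                    ∎

  product-falling : ∀ u k → product k (λ i → fromℕ i - u) ≈ (- 1#) ^ k * falling u k
  product-falling u zero    = sym (*-identityˡ 1#)
  product-falling u (suc k) = trans (*-congʳ (product-falling u k))
    (solve 4 (λ u k s f → s :* f :* (k :- u) := (:- :1) :* s :* (f :* (u :- k))) refl
      u (fromℕ k) ((- 1#) ^ k) (falling u k))

  product-rising : ∀ u k → product k (λ i → u + fromℕ (suc i)) ≈ falling (u + fromℕ k) k
  product-rising u zero    = refl
  product-rising u (suc k) = begin
    product k (λ i → u + fromℕ (suc i)) * (u + fromℕ (suc k))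
      ≈⟨ *-cong (product-rising u k) eq ⟩
    falling (u + fromℕ k) k * (u + fromℕ k + 1#)
      ≈⟨ *-comm _ _ ⟩
    (u + fromℕ k + 1#) * falling (u + fromℕ k) k
      ≈⟨ falling-suc (u + fromℕ k) k ⟨
    falling (u + fromℕ k + 1#) (suc k)
      ≈⟨ falling-cong (suc k) eq ⟨
    falling (u + fromℕ (suc k)) (suc k) ∎
    where
    eq : u + fromℕ (suc k) ≈ u + fromℕ k + 1#
    eq = solve 2 (λ u k → u :+ (:1 :+ k) := u :+ k :+ :1) refl u (fromℕ k)

  product-1 : ∀ n {f} → (∀ {i} → i ℕ.< n → f i ≈ 1#) → product n f ≈ 1#
  product-1 zero    f≈1 = refl
  product-1 (suc n) f≈1 = trans
    (*-cong (product-1 n λ i<n → f≈1 (ℕ.m<n⇒m<1+n i<n)) (f≈1 ℕ.≤-refl)) (*-identityˡ 1#)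

  -- 1/(i - j), with the junk value 1 on the diagonal that the residues expect.
  ε : ℕ → ℕ → Carrier
  ε zero    zero    = 1#
  ε zero    (suc j) = - recip (fromℕ#0 j)
  ε (suc i) zero    = recip (fromℕ#0 i)
  ε (suc i) (suc j) = ε i j

  ε-diagonal : ∀ j → ε j j ≈ 1#
  ε-diagonal zero    = refl
  ε-diagonal (suc j) = ε-diagonal j

  ε-inverse : ∀ i j → ¬ i ≡ j → (fromℕ i - fromℕ j) * ε i j ≈ 1#
  ε-inverse zero    zero    0≢0 = contradiction ≡.refl 0≢0
  ε-inverse zero    (suc j) _   = trans
    (solve 2 (λ a e → (:0 :- a) :* (:- e) := a :* e) refl (fromℕ (suc j)) (recip (fromℕ#0 j)))
    (*-recip (fromℕ#0 j))
  ε-inverse (suc i) zero    _   = trans (*-congʳ (x-0≈x _)) (*-recip (fromℕ#0 i))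
  ε-inverse (suc i) (suc j) i≢j = trans
    (*-congʳ (solve 2 (λ a b → :1 :+ a :- (:1 :+ b) := a :- b) refl (fromℕ i) (fromℕ j)))
    (ε-inverse i j λ eq → i≢j (cong suc eq))

  -- Indices below j contribute the inverse of (-1)^j j!, those above it the inverse of q!, and the
  -- diagonal 1. Hence the induction on the number `q` of indices above j, starting with j as the
  -- last index.
  product-ε : ∀ j q {m} → j ℕ.+ q ≡ m →
    product (suc m) (λ i → ε i j) * ((- 1#) ^ j * fromℕ (j !) * fromℕ (q !)) ≈ 1#
  product-ε j zero {m} j+0≡m with ≡.trans (≡.sym (ℕ.+-identityʳ j)) j+0≡m
  ... | ≡.refl = begin
    P * ε j j * (s * fromℕ (j !) * (1# + 0#))
      ≈⟨ *-congʳ (*-congˡ (ε-diagonal j)) ⟩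
    P * 1# * (s * fromℕ (j !) * (1# + 0#))
      ≈⟨ solve 3 (λ P s f → P :* :1 :* (s :* f :* (:1 :+ :0)) := s :* f :* P)
           refl P s (fromℕ (j !)) ⟩
    s * fromℕ (j !) * P
      ≈⟨ *-congʳ (trans (product-falling (fromℕ j) j) (*-congˡ (falling-! j))) ⟨
    product j (λ i → fromℕ i - fromℕ j) * P
      ≈⟨ product-* j _ _ ⟨
    product j (λ i → (fromℕ i - fromℕ j) * ε i j)
      ≈⟨ product-1 j (λ {i} i<j → ε-inverse i j (ℕ.<⇒≢ i<j)) ⟩
    1# ∎
    where
    P = product j (λ i → ε i j)
    s = (- 1#) ^ j
  product-ε j (suc q) {m} j+q≡m with ≡.trans (≡.sym (ℕ.+-suc j q)) j+q≡m
  ... | ≡.refl = begin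
    P * e * (s * fromℕ (j !) * fromℕ (suc q !))
      ≈⟨ *-congˡ (*-congˡ (fromℕ-! q)) ⟩
    P * e * (s * fromℕ (j !) * ((1# + fromℕ q) * fromℕ (q !)))
      ≈⟨ solve 7 (λ P e s f q g κ → P :* e :* (s :* f :* ((:1 :+ q) :* g))
           := P :* (s :* f :* g) :* ((:1 :+ (κ :+ q) :- κ) :* e))
           refl P e s (fromℕ (j !)) (fromℕ q) (fromℕ (q !)) (fromℕ j) ⟩
    P * (s * fromℕ (j !) * fromℕ (q !)) * ((1# + (fromℕ j + fromℕ q) - fromℕ j) * e)
      ≈⟨ *-congˡ (*-congʳ (+-congʳ (+-congˡ (×-homo-+ 1# j q)))) ⟨
    P * (s * fromℕ (j !) * fromℕ (q !)) * ((fromℕ (suc (j ℕ.+ q)) - fromℕ j) * e)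
      ≈⟨ *-cong (product-ε j q ≡.refl)
           (ε-inverse (suc (j ℕ.+ q)) j λ eq → ℕ.<-irrefl (≡.sym eq) (ℕ.s≤s (ℕ.m≤m+n j q))) ⟩
    1# * 1#
      ≈⟨ *-identityˡ 1# ⟩
    1# ∎
    where
    P = product (suc (j ℕ.+ q)) (λ i → ε i j)
    e = ε (suc (j ℕ.+ q)) j
    s = (- 1#) ^ j

  -- Gosper summation of a term known by its initial value and ratio

  module Terminating (m : ℕ) (y : Carrier) (t : ℕ → Carrier) (t₀ : t 0 ≈ 1#)
    (t-ratio : ∀ k → k ℕ.≤ m →
      t (suc k) * (fromℕ (suc k) * (fromℕ (suc k) + y - fromℕ (suc m)))
        ≈ t k * ((fromℕ k - fromℕ (suc m)) * (fromℕ k + (y - 1#))))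
    (c#0 : ∀ k → k ℕ.≤ m → fromℕ (suc k) + y - fromℕ (suc m) # 0#) where

    private
      n = suc m
      ν = fromℕ n
      -- The coefficient of `t 0` in `V 0`; multiplying partial sums by it keeps the antidifference
      -- free of division.
      N = ν * (ν - 1#) * (y * (y - 1#))

    V : ℕ → Carrier
    V k = ((ν - 1#) * y - fromℕ k) * (ν - fromℕ k) * (fromℕ k + (y - 1#)) * t k

    -- V is the antidifference found by Gosper's algorithm.
    partial-sums : ∀ k → k ℕ.≤ n → N * sum (suc k) t ≈ V k
    partial-sums zero    _   = begin
      N * (0# + t 0) ≈⟨ solve 3 (λ n y t → n :* (n :- :1) :* (y :* (y :- :1)) :* (:0 :+ t)
         := ((n :- :1) :* y :- :0) :* (n :- :0) :* (:0 :+ (y :- :1)) :* t) refl ν y (t 0) ⟩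
      V 0 ∎
    partial-sums (suc k) (ℕ.s≤s k≤m) = begin
      N * (sum (suc k) t + t (suc k))
        ≈⟨ distribˡ N _ _ ⟩
      N * sum (suc k) t + N * t (suc k)
        ≈⟨ +-congʳ (partial-sums k (ℕ.m≤n⇒m≤1+n k≤m)) ⟩
      V k + N * t (suc k)
        ≈⟨ +-congʳ (solve 4 (λ n y κ t → ((n :- :1) :* y :- κ) :* (n :- κ) :* (κ :+ (y :- :1)) :* t
             := :- (((n :- :1) :* y :- κ) :* (t :* ((κ :- n) :* (κ :+ (y :- :1))))))
             refl ν y κ (t k)) ⟩
      - (((ν - 1#) * y - κ) * (t k * ((κ - ν) * (κ + (y - 1#))))) + N * t (suc k)
        ≈⟨ +-congʳ (-‿cong (*-congˡ (t-ratio k k≤m))) ⟨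
      - (((ν - 1#) * y - κ) * (t (suc k) * (fromℕ (suc k)
          * (fromℕ (suc k) + y - ν)))) + N * t (suc k)
        ≈⟨ solve 4 (λ n y κ t →
            :- (((n :- :1) :* y :- κ) :* (t :* ((:1 :+ κ) :* (:1 :+ κ :+ y :- n))))
              :+ n :* (n :- :1) :* (y :* (y :- :1)) :* t
             := ((n :- :1) :* y :- (:1 :+ κ)) :* (n :- (:1 :+ κ)) :* (:1 :+ κ :+ (y :- :1)) :* t)
             refl ν y κ (t (suc k)) ⟩
      V (suc k) ∎
      where κ = fromℕ k

    -- The recurrence `t-ratio` solved, with denominators cleared. Passing from j to j + 1 slides
    -- the window of the falling factorial of u = j + y - 1: the factor u + 1 enters at the top, and
    -- u + 1 - m, which is the denominator `d` of the ratio, leaves at the bottom.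
    term-closed : ∀ j q → j ℕ.+ q ≡ m →
      (- 1#) ^ j * (t j * (fromℕ (suc q !) * fromℕ (j !)) * (fromℕ j + (y - 1#))) * falling y n
        ≈ fromℕ (n !) * (y * (y - 1#)) * falling (fromℕ j + (y - 1#)) m
    term-closed zero    q ≡.refl = begin
      1# * (t 0 * (M * (1# + 0#)) * (0# + (y - 1#))) * falling y n
        ≈⟨ *-cong (*-congˡ (*-congʳ (*-congʳ t₀)))
             (trans (falling-cong n (solve 1 (λ y → y
                 := y :- :1 :+ :1) refl y)) (falling-suc (y - 1#) m)) ⟩
      1# * (1# * (M * (1# + 0#)) * (0# + (y - 1#))) * ((y - 1# + 1#) * falling (y - 1#) m)
        ≈⟨ solve 3 (λ M y f →
            :1 :* (:1 :* (M :* (:1 :+ :0)) :* (:0 :+ (y :- :1))) :* ((y :- :1 :+ :1) :* f)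
              := M :* (y :* (y :- :1)) :* f) refl M y (falling (y - 1#) m) ⟩
      M * (y * (y - 1#)) * falling (y - 1#) m
        ≈⟨ *-congˡ (falling-cong m (+-identityˡ (y - 1#))) ⟨
      M * (y * (y - 1#)) * falling (0# + (y - 1#)) m ∎
      where M = fromℕ (n !)
    term-closed (suc j) q j+q≡m = *-cancelʳ (c#0 j j≤m) (begin
      (- 1#) * s * (t (suc j) * (Q * fromℕ (suc j !)) * u′) * F * d
        ≈⟨ *-congʳ (*-congʳ (*-congˡ (*-congʳ (*-congˡ (*-congˡ (fromℕ-! j)))))) ⟩
      (- 1#) * s * (t (suc j) * (Q * (fromℕ (suc j) * J)) * u′) * F * d
        ≈⟨ solve 8 (λ s t Q k J u F d → (:- :1) :* s :* (t :* (Q :* (k :* J)) :* u) :* F :* d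
             := (:- (s :* (Q :* J) :* u :* F)) :* (t :* (k :* d)))
             refl s (t (suc j)) Q (fromℕ (suc j)) J u′ F d ⟩
      (- (s * (Q * J) * u′ * F)) * (t (suc j) * (fromℕ (suc j) * d))
        ≈⟨ *-congˡ (t-ratio j j≤m) ⟩
      (- (s * (Q * J) * u′ * F)) * (t j * ((fromℕ j - ν) * u))
        ≈⟨ *-congˡ (*-congˡ (*-congʳ (+-congˡ (-‿cong ν≈)))) ⟩
      (- (s * (Q * J) * u′ * F)) * (t j * ((fromℕ j - (1# + (fromℕ j + fromℕ (suc q)))) * u))
        ≈⟨ solve 9 (λ s Q J u′ F t κ ρ u →
            (:- (s :* (Q :* J) :* u′ :* F)) :* (t :* ((κ :- (:1 :+ (κ :+ ρ))) :* u))
             := s :* (t :* ((:1 :+ ρ) :* Q :* J) :* u) :* F :* u′)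
             refl s Q J u′ F (t j) (fromℕ j) (fromℕ (suc q)) u ⟩
      s * (t j * (fromℕ (suc (suc q)) * Q * J) * u) * F * u′
        ≈⟨ *-congʳ (*-congʳ (*-congˡ (*-congʳ (*-congˡ (*-congʳ (fromℕ-! (suc q))))))) ⟨
      s * (t j * (fromℕ (suc (suc q) !) * J) * u) * F * u′
        ≈⟨ *-congʳ (term-closed j (suc q) j+1+q≡m) ⟩
      M * falling u m * u′
        ≈⟨ *-congˡ u′≈ ⟩
      M * falling u m * (u + 1#)
        ≈⟨ solve 3 (λ M f u → M :* f :* u := M :* (u :* f)) refl M (falling u m) (u + 1#) ⟩
      M * ((u + 1#) * falling u m)
        ≈⟨ *-congˡ (falling-suc u m) ⟨
      M * (falling (u + 1#) m * (u + 1# - fromℕ m))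
        ≈⟨ *-congˡ (*-cong (falling-cong m (sym u′≈))
             (solve 3 (λ κ y m → κ :+ (y :- :1) :+ :1 :- m
                 := :1 :+ κ :+ y :- (:1 :+ m)) refl (fromℕ j) y (fromℕ m))) ⟩
      M * (falling u′ m * d)
        ≈⟨ *-assoc M _ d ⟨
      M * falling u′ m * d ∎)
      where
      s = (- 1#) ^ j
      u = fromℕ j + (y - 1#)
      u′ = fromℕ (suc j) + (y - 1#)
      d = fromℕ (suc j) + y - ν
      F = falling y n
      Q = fromℕ (suc q !)
      J = fromℕ (j !)
      M = fromℕ (n !) * (y * (y - 1#))
      j+1+q≡m : j ℕ.+ suc q ≡ m
      j+1+q≡m = ≡.trans (ℕ.+-suc j q) j+q≡m
      j≤m : j ℕ.≤ m
      j≤m = ℕ.≤-trans (ℕ.m≤m+n j (suc q)) (ℕ.≤-reflexive j+1+q≡m)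
      ν≈ : ν ≈ 1# + (fromℕ j + fromℕ (suc q))
      ν≈ = +-congˡ (trans (reflexive (cong fromℕ (≡.sym j+1+q≡m))) (×-homo-+ 1# j (suc q)))
      u′≈ : u′ ≈ u + 1#
      u′≈ = solve 2 (λ κ z → :1 :+ κ :+ z := κ :+ z :+ :1) refl (fromℕ j) (y - 1#)

    node : ℕ → Carrier
    node j = fromℕ (suc j)

    -- The roots of the numerator are - root i.
    root : ℕ → Carrier
    root zero    = 1# - y + ν * y
    root (suc i) = fromℕ (suc (suc i)) - y

    private
      ε-inverse′ : ∀ i j → ¬ i ≡ j → (node i - node j) * ε i j ≈ 1#
      ε-inverse′ i j i≢j = ε-inverse (suc i) (suc j) λ eq → i≢j (ℕ.suc-injective eq)

    res : ℕ → ℕ → Carrier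
    res = residue node root ε ε-diagonal ε-inverse′

    scale : Carrier
    scale = (- 1#) ^ n * (fromℕ (n !) * (y * (y - 1#)))

    -- Of the factors of `V j` in front of `t j`, the first is `root 0 - node j`, the second extends
    -- (m - j)! to (n - j)!, and the third is the one that `term-closed` expects. The denominators
    -- of the residue come from `product-ε`.
    V≈residue : ∀ j → j ℕ.≤ m → V j * falling y n ≈ - (scale * res n j)
    V≈residue j j≤m = begin
      r * (ν - κ) * u * t j * F
        ≈⟨ *-identityˡ _ ⟨
      1# * (r * (ν - κ) * u * t j * F)
        ≈⟨ *-cong (product-ε j q j+q≡m) (*-congʳ (*-congʳ (*-congʳ (*-congˡ 1+q≈ν-κ)))) ⟨
      E * (s * J * fromℕ (q !)) * (r * fromℕ (suc q) * u * t j * F)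
        ≈⟨ solve 9 (λ E s J q! r q u t F → E :* (s :* J :* q!) :* (r :* q :* u :* t :* F)
             := E :* r :* (s :* (t :* (q :* q! :* J) :* u) :* F))
                 refl E s J (fromℕ (q !)) r (fromℕ (suc q)) u (t j) F ⟩
      E * r * (s * (t j * (fromℕ (suc q) * fromℕ (q !) * J) * u) * F)
        ≈⟨ *-congˡ (*-congʳ (*-congˡ (*-congʳ (*-congˡ (*-congʳ (fromℕ-! q)))))) ⟨
      E * r * (s * (t j * (fromℕ (suc q !) * J) * u) * F)
        ≈⟨ *-congˡ (term-closed j q j+q≡m) ⟩
      E * r * (M * falling u m)
        ≈⟨ *-identityˡ _ ⟨
      1# * (E * r * (M * falling u m))
        -- One copy of (-1)^m turns the falling factorial into the product over the roots; the other
        -- becomes the (-1)^n of `scale`, at the cost of the minus sign in front.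
        ≈⟨ *-congʳ (signs-cancel m) ⟨
      σ * σ * (E * r * (M * falling u m))
        ≈⟨ solve 5 (λ σ E r M f → σ :* σ :* (E :* r :* (M :* f))
             := :- ((:- :1) :* σ :* M :* (r :* (σ :* f) :* E))) refl σ E r M (falling u m) ⟩
      - (scale * (r * (σ * falling u m) * E))
        ≈⟨ -‿cong (*-congˡ (*-congʳ numerator)) ⟨
      - (scale * (product n (λ i → root i - node j) * E))
        ≈⟨ -‿cong (*-congˡ (product-* n _ _)) ⟨
      - (scale * res n j) ∎
      where
      q = m ℕ.∸ j
      κ = fromℕ j
      j+q≡m : j ℕ.+ q ≡ m
      j+q≡m = ℕ.m+[n∸m]≡n j≤m
      r = (ν - 1#) * y - κ
      u = κ + (y - 1#)
      F = falling y n
      E = product n (λ i → ε i j)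
      s = (- 1#) ^ j
      σ = (- 1#) ^ m
      J = fromℕ (j !)
      M = fromℕ (n !) * (y * (y - 1#))
      1+q≈ν-κ : fromℕ (suc q) ≈ ν - κ
      1+q≈ν-κ = begin
        1# + fromℕ q
          ≈⟨ solve 2 (λ κ q → :1 :+ q := :1 :+ (κ :+ q) :- κ) refl κ (fromℕ q) ⟩
        1# + (κ + fromℕ q) - κ
          ≈⟨ +-congʳ (+-congˡ (trans (reflexive (cong fromℕ (≡.sym j+q≡m))) (×-homo-+ 1# j q))) ⟨
        ν - κ ∎
      numerator : product n (λ i → root i - node j) ≈ r * (σ * falling u m)
      numerator = begin
        product n (λ i → root i - node j)
          ≈⟨ product-head m _ ⟩
        (1# - y + ν * y - node j) * product m (λ i → root (suc i) - node j)
          ≈⟨ *-cong (solve 3 (λ n y κ → :1 :- y :+ n :* y :- (:1 :+ κ)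
              := (n :- :1) :* y :- κ) refl ν y κ)
               (product-cong m λ {i} _ → solve 3 (λ i y κ → :1 :+ (:1 :+ i) :- y :- (:1 :+ κ)
                  := i :- (κ :+ (y :- :1))) refl (fromℕ i) y κ) ⟩
        r * product m (λ i → fromℕ i - u)
          ≈⟨ *-congˡ (product-falling u m) ⟩
        r * (σ * falling u m) ∎

    harmonic-sum : ∀ x (w v : ℕ → Carrier) →
      (∀ {i} → i ℕ.< n → (x + node i) * w i ≈ 1#) → (∀ {i} → i ℕ.< n → (x + root i) * v i ≈ 1#) →
      N * falling y n * sum (suc n) (λ k → t k * sum k (λ j → w j * w j))
        ≈ scale * (product n (λ i → (x + root i) * w i) * sum n (λ i → w i - v i))
    harmonic-sum x w v w⁻¹ v⁻¹ = begin
      N * F * sum (suc n) (λ k → t k * sum k h)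
        ≈⟨ *-congˡ (summation-by-parts n t h) ⟩
      N * F * (T * sum n h - S)
        ≈⟨ solve 5 (λ N F T H S → N :* F :* (T :* H :- S)
            := F :* H :* (N :* T) :- F :* (N :* S)) refl N F T (sum n h) S ⟩
      F * sum n h * (N * T) - F * (N * S)
        ≈⟨ +-cong (*-congˡ (partial-sums n ℕ.≤-refl)) (-‿cong (*-congˡ (sym (*-sum n N _)))) ⟩
      F * sum n h * V n - F * sum n (λ j → N * (h j * sum (suc j) t))
        -- `V n` contains the factor n - n, so the boundary term of the summation by parts drops
        -- out.
        ≈⟨ +-cong
            (solve 5 (λ F H n y t →
            F :* H :* (((n :- :1) :* y :- n) :* (n :- n) :* (n :+ (y :- :1)) :* t)
                := :0) refl F (sum n h) ν y (t n))
             (-‿cong (sym (*-sum n F _))) ⟩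
      0# - sum n (λ j → F * (N * (h j * sum (suc j) t)))
        ≈⟨ +-congˡ (-‿cong (sum-cong n λ {j} j<n → residue-term j j<n)) ⟩
      0# - sum n (λ j → (- scale) * (res n j * h j))
        ≈⟨ +-congˡ (-‿cong (*-sum n (- scale) _)) ⟩
      0# - (- scale) * sum n (λ j → res n j * h j)
        ≈⟨ solve 2 (λ a b → :0 :- (:- a) :* b := a :* b) refl scale _ ⟩
      scale * sum n (λ j → res n j * h j)
        ≈⟨ *-congˡ (partial-fractions′ node root ε ε-diagonal ε-inverse′ n x w v w⁻¹ v⁻¹) ⟩
      scale * (product n (λ i → (x + root i) * w i) * sum n (λ i → w i - v i)) ∎
      where
      F = falling y n
      h = λ j → w j * w j
      T = sum (suc n) t
      S = sum n (λ j → h j * sum (suc j) t)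
      residue-term : ∀ j → j ℕ.< n → F * (N * (h j * sum (suc j) t)) ≈ (- scale) * (res n j * h j)
      residue-term j (ℕ.s≤s j≤m) = begin
        F * (N * (h j * sum (suc j) t))
          ≈⟨ solve 4 (λ F N h s → F :* (N :* (h :* s)) := h :* (N :* s :* F)) refl F N (h j) _ ⟩
        h j * (N * sum (suc j) t * F)
          ≈⟨ *-congˡ (trans (*-congʳ (partial-sums j (ℕ.m≤n⇒m≤1+n j≤m))) (V≈residue j j≤m)) ⟩
        h j * - (scale * res n j)
          ≈⟨ solve 3 (λ h a r → h :* (:- (a :* r))
              := (:- a) :* (r :* h)) refl (h j) scale (res n j) ⟩
        (- scale) * (res n j * h j) ∎

-- Harmonic numbers and binomials without their apartness proofs

module HarmonicIdentity {c ℓ₁ ℓ₂} (K : HeytingField c ℓ₁ ℓ₂)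
  (fromℕ#0 : ∀ n → HeytingField._#_ K (Identities.fromℕ K (suc n)) (HeytingField.0# K)) where

  open HeytingField K
  open Identities K
  open CharacteristicZero fromℕ#0
  open Hypergeometric K fromℕ#0
  open HeytingProperties heytingCommutativeRing using (#-congʳ)
  open CommutativeRing R using (semiring)
  open import Algebra.Properties.Semiring.Mult semiring using (×-homo-+)
  open IntegerCoefficients R
  open PartialFractions R
  open import Relation.Binary.Reasoning.Setoid setoid

  -- Sums are indexed by ℕ, but the inverses exist only up to n; the value 0# beyond is junk.
  extend : ∀ n → (∀ k → k ℕ.≤ n → Carrier) → ℕ → Carrier
  extend n f k with k ℕ.≤? n
  ... | yes k≤n = f k k≤n
  ... | no  _   = 0#

  extend-≡ : ∀ n f {k} (k≤n : k ℕ.≤ n) → extend n f k ≡ f k k≤n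
  extend-≡ n f {k} k≤n with k ℕ.≤? n
  ... | yes k≤n′ = cong (f k) (ℕ.≤-irrelevant k≤n′ k≤n)
  ... | no  k≰n  = contradiction k≤n k≰n

  ∑-sum : ∀ n {f : Fin n → Carrier} {g : ℕ → Carrier} →
          (∀ i → f i ≈ g (toℕ i)) → sum-syntax n f ≈ sum n g
  ∑-sum zero    f≈g = refl
  ∑-sum (suc n) f≈g = trans
    (+-cong (f≈g Fin.zero) (∑-sum n λ i → f≈g (Fin.suc i))) (sym (sum-head n _))

  ^-inverse : ∀ {a w} ℓ → a * w ≈ 1# → a ^ ℓ * w ^ ℓ ≈ 1#
  ^-inverse zero    aw≈1 = *-identityˡ 1#
  ^-inverse {a} {w} (suc ℓ) aw≈1 = begin
    a * a ^ ℓ * (w * w ^ ℓ)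
      ≈⟨ solve 4 (λ a w b v → a :* b :* (w :* v) := a :* w :* (b :* v)) refl a w (a ^ ℓ) (w ^ ℓ) ⟩
    a * w * (a ^ ℓ * w ^ ℓ) ≈⟨ *-cong aw≈1 (^-inverse ℓ aw≈1) ⟩
    1# * 1#                 ≈⟨ *-identityˡ 1# ⟩
    1#                      ∎

  -- Makes a reciprocal independent of the apartness proof it was built from, so that the quotients
  -- of the statement can be matched with the inverses used in the proof.
  recip-unique : ∀ {a w} (a#0 : a # 0#) → a * w ≈ 1# → recip a#0 ≈ w
  recip-unique {a} {w} a#0 aw≈1 = *-cancelʳ a#0
    (trans (trans (*-comm _ a) (*-recip a#0)) (sym (trans (*-comm w a) aw≈1)))

  -- The proofs inside `H` vary with its length. Through this lemma all harmonic numbers of the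
  -- left-hand side share a single sequence of inverses, as summation by parts requires.
  H-sum : ∀ ℓ n u u# (w : ℕ → Carrier) → (∀ {i} → i ℕ.< n → (u + fromℕ (suc i)) * w i ≈ 1#) →
          H ℓ n u u# ≈ sum n (λ i → w i ^ ℓ)
  H-sum ℓ n u u# w w⁻¹ = ∑-sum n λ i →
    trans (*-identityˡ _) (recip-unique _ (^-inverse ℓ (w⁻¹ (toℕ<n i))))

  /-* : ∀ a {b} (b#0 : b # 0#) → a / b ⟨ b#0 ⟩ * b ≈ a
  /-* a {b} b#0 = begin
    a * recip b#0 * b     ≈⟨ *-assoc a _ b ⟩
    a * (recip b#0 * b)   ≈⟨ *-congˡ (trans (*-comm _ b) (*-recip b#0)) ⟩
    a * 1#                ≈⟨ *-identityʳ a ⟩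
    a                     ∎

  recip-! : ∀ k → recip (!#0 (suc k)) * fromℕ (suc k) ≈ recip (!#0 k)
  recip-! k = sym (recip-unique (!#0 k) (begin
    fromℕ (k !) * (recip (!#0 (suc k)) * fromℕ (suc k))
      ≈⟨ solve 3 (λ f r k → f :* (r :* k) := k :* f :* r) refl (fromℕ (k !)) _ (fromℕ (suc k)) ⟩
    fromℕ (suc k) * fromℕ (k !) * recip (!#0 (suc k))
      ≈⟨ *-congʳ (fromℕ-! k) ⟨
    fromℕ (suc k !) * recip (!#0 (suc k))
      ≈⟨ *-recip (!#0 (suc k)) ⟩
    1# ∎))

  binom-step : ∀ u k → binom u (suc k) * fromℕ (suc k) ≈ binom u k * (u - fromℕ k)
  binom-step u k = begin
    falling u k * (u - fromℕ k) * recip (!#0 (suc k)) * fromℕ (suc k)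
      ≈⟨ solve 4 (λ f d r k → f :* d :* r :* k := f :* (r :* k) :* d) refl
           (falling u k) (u - fromℕ k) _ (fromℕ (suc k)) ⟩
    falling u k * (recip (!#0 (suc k)) * fromℕ (suc k)) * (u - fromℕ k)
      ≈⟨ *-congʳ (*-congˡ (recip-! k)) ⟩
    binom u k * (u - fromℕ k) ∎

  -- Upper and lower entry grow together, as in both binomials of `Q`; the factor k + 1 common to
  -- the two then cancels in `Q-ratio`.
  binom-suc : ∀ u k → binom (u + fromℕ (suc k)) (suc k) * fromℕ (suc k)
                        ≈ (u + fromℕ (suc k)) * binom (u + fromℕ k) k
  binom-suc u k = begin
    falling (u + fromℕ (suc k)) (suc k) * recip (!#0 (suc k)) * fromℕ (suc k)
      ≈⟨ trans (*-assoc _ _ _) (*-cong (trans (falling-cong (suc k) eq)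
          (falling-suc (u + fromℕ k) k)) (recip-! k)) ⟩
    (u + fromℕ k + 1#) * falling (u + fromℕ k) k * recip (!#0 k)
      ≈⟨ *-assoc _ _ _ ⟩
    (u + fromℕ k + 1#) * binom (u + fromℕ k) k
      ≈⟨ *-congʳ eq ⟨
    (u + fromℕ (suc k)) * binom (u + fromℕ k) k ∎
    where
    eq : u + fromℕ (suc k) ≈ u + fromℕ k + 1#
    eq = solve 2 (λ u k → u :+ (:1 :+ k) := u :+ k :+ :1) refl u (fromℕ k)

  -- The identity over a Heyting field of characteristic zero

  module _ (m : ℕ) (2≤n : 2 ℕ.≤ suc m) (x y : Carrier)
    (x# : ∀ k → 1 ℕ.≤ k → k ℕ.≤ suc m → x # - fromℕ k)
    (x-y# : ∀ k → 1 ℕ.≤ k → k ℕ.≤ suc m → x - y # - fromℕ k)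
    (1+x-y+ny#0 : 1# + x - y + fromℕ (suc m) * y # 0#)
    (y# : ∀ j → ℤ.- (ℤ.+ suc m) ℤ.≤ j → j ℤ.< ℤ.+ suc m → y # fromℤ j) where

    private
      n = suc m
      ν = fromℕ n
      A = 1# + x - y + ν * y
      D = 1# + x - y
      D#0 = 1+x-y#0 n 2≤n x y x-y#
      Q#0 = [y+k-1][y+k]#0 n y y# 2≤n
      C#0 = binom[y-n+k]#0 n y y#

      Q : ∀ k → k ℕ.≤ n → Carrier
      Q k k≤n = binom (y + fromℕ k) k / binom (y - ν + fromℕ k) k ⟨ C#0 k k≤n ⟩

      P : ∀ k → k ℕ.≤ n → Carrier
      P k k≤n = (y - 1#) * y / ((y + fromℕ k - 1#) * (y + fromℕ k)) ⟨ Q#0 k k≤n ⟩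

      Q-ratio : ∀ k k≤n k<n → Q (suc k) k<n * (y - ν + fromℕ (suc k)) ≈
          (y + fromℕ (suc k)) * Q k k≤n
      Q-ratio k k≤n k<n = *-cancelʳ (C#0 k k≤n) (begin
        Q′ * d * C
          ≈⟨ *-assoc Q′ d C ⟩
        Q′ * (d * C)
          ≈⟨ *-congˡ (binom-suc (y - ν) k) ⟨
        Q′ * (C′ * κ)
          ≈⟨ *-assoc Q′ C′ κ ⟨
        Q′ * C′ * κ
          ≈⟨ *-congʳ (/-* _ (C#0 (suc k) k<n)) ⟩
        binom (y + κ) (suc k) * κ
          ≈⟨ binom-suc y k ⟩
        (y + κ) * binom (y + fromℕ k) k
          ≈⟨ *-congˡ (/-* _ (C#0 k k≤n)) ⟨
        (y + κ) * (Q k k≤n * C)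
          ≈⟨ *-assoc _ _ _ ⟨
        (y + κ) * Q k k≤n * C ∎)
        where
        κ  = fromℕ (suc k)
        d  = y - ν + κ
        Q′ = Q (suc k) k<n
        C  = binom (y - ν + fromℕ k) k
        C′ = binom (y - ν + κ) (suc k)

      -- Consecutive denominators share the factor y + k. The factor y + k + 1 on the left is the
      -- one that `Q-ratio` produces, and `t-ratio` combines the two so that it disappears.
      P-ratio : ∀ k k≤n k<n → P (suc k) k<n * (y + fromℕ (suc k)) ≈ P k k≤n * (fromℕ k + (y - 1#))
      P-ratio k k≤n k<n = *-cancelʳ (Q#0 k k≤n) (begin
        P′ * (y + (1# + κ)) * ((y + κ - 1#) * (y + κ))
          ≈⟨ solve 3 (λ p y k → p :* (y :+ (:1 :+ k)) :* ((y :+ k :- :1) :* (y :+ k))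
               := p :* ((y :+ (:1 :+ k) :- :1) :* (y :+ (:1 :+ k))) :* (k :+ (y :- :1)))
               refl P′ y κ ⟩
        P′ * ((y + (1# + κ) - 1#) * (y + (1# + κ))) * (κ + (y - 1#))
          ≈⟨ *-congʳ (/-* _ (Q#0 (suc k) k<n)) ⟩
        (y - 1#) * y * (κ + (y - 1#))
          ≈⟨ *-congʳ (/-* _ (Q#0 k k≤n)) ⟨
        P k k≤n * ((y + κ - 1#) * (y + κ)) * (κ + (y - 1#))
          ≈⟨ solve 3 (λ p q u → p :* q :* u := p :* u :* q) refl (P k k≤n) _ _ ⟩
        P k k≤n * (κ + (y - 1#)) * ((y + κ - 1#) * (y + κ)) ∎)
        where
        κ = fromℕ k
        P′ = P (suc k) k<n

      term : ∀ k → k ℕ.≤ n → Carrier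
      term k k≤n = (- 1#) ^ k * binom ν k * Q k k≤n * P k k≤n

      t : ℕ → Carrier
      t = extend n term

      t-zero : t 0 ≈ 1#
      t-zero = begin
        t 0
          ≡⟨ extend-≡ n term ℕ.z≤n ⟩
        1# * (1# * r) * (1# * r * q) * ((y - 1#) * y * p)
          -- Every binomial with lower entry 0 is `1# * r` with `r` the inverse of 0!, and the
          -- numerator (y - 1) y is the denominator of `P` at k = 0.
          ≈⟨ solve 4 (λ y r q p → :1 :* (:1 :* r) :* (:1 :* r :* q) :* ((y :- :1) :* y :* p)
               := r :* (:1 :* r :* q) :* ((y :+ :0 :- :1) :* (y :+ :0) :* p)) refl y r q p ⟩
        r * (1# * r * q) * ((y + 0# - 1#) * (y + 0#) * p)
          ≈⟨ *-cong (*-congˡ (*-recip (C#0 0 ℕ.z≤n))) (*-recip (Q#0 0 ℕ.z≤n)) ⟩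
        r * 1# * 1#
          ≈⟨ solve 1 (λ r → r :* :1 :* :1 := (:1 :+ :0) :* r) refl r ⟩
        (1# + 0#) * r
          ≈⟨ *-recip (!#0 0) ⟩
        1# ∎
        where
        r = recip (!#0 0)
        q = recip (C#0 0 ℕ.z≤n)
        p = recip (Q#0 0 ℕ.z≤n)

      t-ratio : ∀ k → k ℕ.≤ m →
        t (suc k) * (fromℕ (suc k) * (fromℕ (suc k) + y - ν)) ≈
            t k * ((fromℕ k - ν) * (fromℕ k + (y - 1#)))
      t-ratio k k≤m = begin
        t (suc k) * (κ′ * (κ′ + y - ν))
          ≡⟨ cong (_* (κ′ * (κ′ + y - ν))) (extend-≡ n term k<n) ⟩
        (- 1#) * s * b′ * q′ * p′ * (κ′ * (κ′ + y - ν))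
          ≈⟨ solve 7 (λ s b q p κ y ν → (:- :1) :* s :* b :* q :* p :* (κ :* (κ :+ y :- ν))
               := (:- (s :* (b :* κ))) :* (q :* (y :- ν :+ κ)) :* p) refl s b′ q′ p′ κ′ y ν ⟩
        (- (s * (b′ * κ′))) * (q′ * (y - ν + κ′)) * p′
          ≈⟨ *-congʳ (*-cong (-‿cong (*-congˡ (binom-step ν k))) (Q-ratio k k≤n k<n)) ⟩
        (- (s * (b * (ν - κ)))) * ((y + κ′) * q) * p′
          ≈⟨ solve 6 (λ s b d e q p → (:- (s :* (b :* d))) :* (e :* q) :* p
              := (:- (s :* b :* q :* d)) :* (p :* e))
               refl s b (ν - κ) (y + κ′) q p′ ⟩
        (- (s * b * q * (ν - κ))) * (p′ * (y + κ′))
          ≈⟨ *-congˡ (P-ratio k k≤n k<n) ⟩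
        (- (s * b * q * (ν - κ))) * (p * (κ + (y - 1#)))
          ≈⟨ solve 7 (λ s b q ν κ p u → (:- (s :* b :* q :* (ν :- κ))) :* (p :* u)
               := s :* b :* q :* p :* ((κ :- ν) :* u)) refl s b q ν κ p (κ + (y - 1#)) ⟩
        s * b * q * p * ((κ - ν) * (κ + (y - 1#)))
          ≡⟨ cong (_* ((κ - ν) * (κ + (y - 1#)))) (extend-≡ n term k≤n) ⟨
        t k * ((κ - ν) * (κ + (y - 1#))) ∎
        where
        k≤n = ℕ.m≤n⇒m≤1+n k≤m
        k<n = ℕ.s≤s k≤m
        κ  = fromℕ k
        κ′ = fromℕ (suc k)
        s  = (- 1#) ^ k
        b  = binom ν k
        b′ = binom ν (suc k)
        q  = Q k k≤n
        q′ = Q (suc k) k<n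
        p  = P k k≤n
        p′ = P (suc k) k<n

      y#ℕ : ∀ j → j ℕ.< n → y - fromℕ j # 0#
      y#ℕ j j<n = a#b⇒a-b#0 (y# (ℤ.+ j) (ℤ.neg-≤-pos {n} {j}) (ℤ.+<+ j<n))

      c#0 : ∀ k → k ℕ.≤ m → fromℕ (suc k) + y - ν # 0#
      c#0 k k≤m = #-congʳ (begin
        y - fromℕ (m ℕ.∸ k)
          ≈⟨ solve 3 (λ y d κ → y :- d
              := :1 :+ κ :+ y :- (:1 :+ (d :+ κ))) refl y (fromℕ (m ℕ.∸ k)) (fromℕ k) ⟩
        fromℕ (suc k) + y - (1# + (fromℕ (m ℕ.∸ k) + fromℕ k))
          ≈⟨ +-congˡ (-‿cong (+-congˡ (×-homo-+ 1# (m ℕ.∸ k) k))) ⟨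
        fromℕ (suc k) + y - fromℕ (suc (m ℕ.∸ k ℕ.+ k))
          ≡⟨ cong (λ l → fromℕ (suc k) + y - fromℕ (suc l)) (ℕ.m∸n+n≡m k≤m) ⟩
        fromℕ (suc k) + y - ν ∎)
        (y#ℕ (m ℕ.∸ k) (ℕ.s≤s (ℕ.m∸n≤m m k)))

      open Terminating m y t t-zero t-ratio c#0

      -- Position i belongs to the denominator with i + 1, hence the bound `m` in `extend`. `v`
      -- inverts x + `root` i; it agrees with `z` except at 0, where the root is 1 - y + n y instead
      -- of 1 - y.
      w z v : ℕ → Carrier
      w = extend m λ k k≤m → recip (a#-b⇒a+b#0 (x# (suc k) (ℕ.s≤s ℕ.z≤n) (ℕ.s≤s k≤m)))
      z = extend m λ k k≤m → recip (a#-b⇒a+b#0 (x-y# (suc k) (ℕ.s≤s ℕ.z≤n) (ℕ.s≤s k≤m)))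
      v zero    = recip 1+x-y+ny#0
      v (suc i) = z (suc i)

      w⁻¹ : ∀ {i} → i ℕ.< n → (x + fromℕ (suc i)) * w i ≈ 1#
      w⁻¹ (ℕ.s≤s i≤m) = trans (*-congˡ (reflexive (extend-≡ m _ i≤m))) (*-recip _)

      z⁻¹ : ∀ {i} → i ℕ.< n → (x - y + fromℕ (suc i)) * z i ≈ 1#
      z⁻¹ (ℕ.s≤s i≤m) = trans (*-congˡ (reflexive (extend-≡ m _ i≤m))) (*-recip _)

      root≈ : ∀ i → x + root (suc i) ≈ x - y + fromℕ (suc (suc i))
      root≈ i = solve 3 (λ x y k → x :+ (k :- y) := x :- y :+ k) refl x y (fromℕ (suc (suc i)))

      root₀≈ : x + root 0 ≈ A
      root₀≈ = solve 3 (λ x y k → x :+ (:1 :- y :+ k) := :1 :+ x :- y :+ k) refl x y (ν * y)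

      v⁻¹ : ∀ {i} → i ℕ.< n → (x + root i) * v i ≈ 1#
      v⁻¹ {zero}  _   = trans (*-congʳ root₀≈) (*-recip 1+x-y+ny#0)
      v⁻¹ {suc i} i<n = trans (*-congʳ (root≈ i)) (z⁻¹ i<n)

      D≈ : D ≈ x - y + fromℕ 1
      D≈ = solve 2 (λ x y → :1 :+ x :- y := x :- y :+ (:1 :+ :0)) refl x y

      Dz≈1 : D * z 0 ≈ 1#
      Dz≈1 = trans (*-congʳ D≈) (z⁻¹ (ℕ.s≤s ℕ.z≤n))

      X Y Z W : Carrier
      X = falling (x + ν) n
      Y = falling y n
      Z = falling (x - y + ν) n
      W = product n w

      XW≈1 : X * W ≈ 1#
      XW≈1 = trans (*-congʳ (sym (product-rising x n)))
        (trans (sym (product-* n _ _)) (product-1 n w⁻¹))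

      product-root : product n (λ i → (x + root i) * w i) ≈ A * z 0 * Z * W
      product-root = begin
        product n (λ i → (x + root i) * w i)
          ≈⟨ trans (product-* n _ _) (*-congʳ (product-head m _)) ⟩
        (x + root 0) * product m (λ i → x + root (suc i)) * W
          ≈⟨ *-congʳ (*-cong root₀≈ (product-cong m λ {i} _ → root≈ i)) ⟩
        A * Z′ * W
          -- `Z′` is the rising product of x - y without its first factor `D`; inserting `D * z 0`
          -- completes it.
          ≈⟨ *-congʳ (*-congʳ (trans (*-congˡ Dz≈1) (*-identityʳ A))) ⟨
        A * (D * z 0) * Z′ * W
          ≈⟨ solve 5 (λ A D z Z W → A :* (D :* z) :* Z :* W
              := A :* z :* (D :* Z) :* W) refl A D (z 0) Z′ W ⟩
        A * z 0 * (D * Z′) * W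
          ≈⟨ *-congʳ (*-congˡ (trans (*-congʳ D≈) (sym (product-head m _)))) ⟩
        A * z 0 * product n (λ i → x - y + fromℕ (suc i)) * W
          ≈⟨ *-congʳ (*-congˡ (product-rising (x - y) n)) ⟩
        A * z 0 * Z * W ∎
        where
        Z′ = product m (λ i → x - y + fromℕ (suc (suc i)))

      -- `z` and `v` differ only at 0, and since A - D = n y, the difference 1/D - 1/A there is
      -- exactly the added fraction.
      harmonic-difference :
        H 1 n x x# - H 1 n (x - y) x-y# + (ν * y / (D * A) ⟨ *-#0 D#0 1+x-y+ny#0 ⟩)
          ≈ sum n (λ i → w i - v i)
      harmonic-difference = begin
        H 1 n x x# - H 1 n (x - y) x-y# + ν * y * recip (*-#0 D#0 1+x-y+ny#0)
          ≈⟨ +-cong (+-cong (first-order x x# w w⁻¹) (-‿cong (first-order (x - y) x-y# z z⁻¹)))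
               (*-congˡ (recip-unique _ DAzv≈1)) ⟩
        sum n w - sum n z + ν * y * (z 0 * v 0)
          ≈⟨ +-congʳ (+-congˡ (-‿cong (sum-head m z))) ⟩
        sum n w - (z 0 + z′) + ν * y * (z 0 * v 0)
          ≈⟨ solve 7 (λ s z t x y c v → s :- (z :+ t) :+ c :* (z :* v)
               := s :- z :- t :+ ((:1 :+ x :- y :+ c) :* v :* z :- (:1 :+ x :- y) :* z :* v))
               refl (sum n w) (z 0) z′ x y (ν * y) (v 0) ⟩
        sum n w - z 0 - z′ + (A * v 0 * z 0 - D * z 0 * v 0)
          ≈⟨ +-congˡ (+-cong (*-congʳ (*-recip 1+x-y+ny#0)) (-‿cong (*-congʳ Dz≈1))) ⟩
        sum n w - z 0 - z′ + (1# * z 0 - 1# * v 0)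
          ≈⟨ solve 4 (λ s z t v → s :- z :- t :+ (:1 :* z :- :1 :* v)
               := :1 :* s :+ (:- :1) :* (v :+ t)) refl (sum n w) (z 0) z′ (v 0) ⟩
        1# * sum n w + (- 1#) * (v 0 + z′)
          ≈⟨ +-congˡ (*-congˡ (sum-head m v)) ⟨
        1# * sum n w + (- 1#) * sum n v
          ≈⟨ sum-linear n 1# (- 1#) w v ⟨
        sum n (λ i → 1# * w i + (- 1#) * v i)
          ≈⟨ sum-cong n (λ {i} _ → solve 2 (λ w v → :1 :* w :+ (:- :1) :* v
              := w :- v) refl (w i) (v i)) ⟩
        sum n (λ i → w i - v i) ∎
        where
        z′ = sum m (λ i → z (suc i))
        first-order : ∀ u u# (w : ℕ → Carrier) → (∀ {i} → i ℕ.< n → (u + fromℕ (suc i)) * w i ≈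
            1#) →
                      H 1 n u u# ≈ sum n w
        first-order u u# w w⁻¹ = trans (H-sum 1 n u u# w w⁻¹) (sum-cong n λ {i} _ →
            *-identityʳ (w i))
        DAzv≈1 : D * A * (z 0 * v 0) ≈ 1#
        DAzv≈1 = begin
          D * A * (z 0 * v 0)
            ≈⟨ solve 4 (λ D A z v → D :* A :* (z :* v) := D :* z :* (A :* v)) refl D A (z 0) (v 0) ⟩
          D * z 0 * (A * v 0)
            ≈⟨ *-cong Dz≈1 (*-recip 1+x-y+ny#0) ⟩
          1# * 1#
            ≈⟨ *-identityˡ 1# ⟩
          1# ∎

      prefactor : (A / (ν * (ν - 1#) * D) ⟨ *-#0 (n[n-1]#0 n 2≤n) D#0 ⟩) * (ν * (ν - 1#)) ≈ A * z 0
      prefactor = begin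
        A * a * (ν * (ν - 1#))
          ≈⟨ *-identityʳ _ ⟨
        A * a * (ν * (ν - 1#)) * 1#
          ≈⟨ *-congˡ Dz≈1 ⟨
        A * a * (ν * (ν - 1#)) * (D * z 0)
          ≈⟨ solve 5 (λ A a n D z → A :* a :* n :* (D :* z)
              := A :* z :* (n :* D :* a)) refl A a (ν * (ν - 1#)) D (z 0) ⟩
        A * z 0 * (ν * (ν - 1#) * D * a)
          ≈⟨ trans (*-congˡ (*-recip (*-#0 (n[n-1]#0 n 2≤n) D#0))) (*-identityʳ _) ⟩
        A * z 0 ∎
        where a = recip (*-#0 (n[n-1]#0 n 2≤n) D#0)

      -- Each binomial carries 1 / n!; two of them below and one above leave a factor n!, the one
      -- contained in `scale`.
      binomials : (b#0 : binom (x + ν) n * binom y n # 0#) →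
        (binom (x - y + ν) n / (binom (x + ν) n * binom y n) ⟨ b#0 ⟩) * Y ≈ fromℕ (n !) * Z * W
      binomials b#0 = begin
        Z * r * e * Y
          ≈⟨ trans (*-identityˡ _) (*-identityˡ _) ⟨
        1# * (1# * (Z * r * e * Y))
          ≈⟨ *-cong XW≈1 (*-congʳ (*-recip (!#0 n))) ⟨
        X * W * (fromℕ (n !) * r * (Z * r * e * Y))
          ≈⟨ solve 7 (λ X W M r Z e Y → X :* W :* (M :* r :* (Z :* r :* e :* Y))
               := M :* Z :* W :* (X :* r :* (Y :* r) :* e)) refl X W (fromℕ (n !)) r Z e Y ⟩
        fromℕ (n !) * Z * W * (X * r * (Y * r) * e)
          ≈⟨ trans (*-congˡ (*-recip b#0)) (*-identityʳ _) ⟩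
        fromℕ (n !) * Z * W ∎
        where
        r = recip (!#0 n)
        e = recip b#0

      left-sum : ∑[ i ≤ n ] (let k = toℕ i in let k≤n = toℕ≤pred[n] i in
          term k k≤n * H 2 k x (λ j 1≤j j≤k → x# j 1≤j (≤-trans j≤k k≤n)))
        ≈ sum (suc n) (λ k → t k * sum k (λ j → w j * w j))
      left-sum = ∑-sum (suc n) λ i → let k = toℕ i ; k≤n = toℕ≤pred[n] i in
        *-cong (reflexive (≡.sym (extend-≡ n term k≤n)))
          (trans (H-sum 2 k x (λ j 1≤j j≤k → x# j 1≤j (≤-trans j≤k k≤n)) w λ j<k →
              w⁻¹ (ℕ.<-≤-trans j<k k≤n))
            (sum-cong k λ {j} _ → *-congˡ (*-identityʳ (w j))))

      y[y-1]#0 : y * (y - 1#) # 0#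
      y[y-1]#0 = *-#0
        (#-congʳ (solve 1 (λ y → y :- :0 := y) refl y) (y#ℕ 0 (ℕ.s≤s ℕ.z≤n)))
        -- The bound 2 ≤ n places 1 among the values that y avoids.
        (#-congʳ (solve 1 (λ y → y :- (:1 :+ :0) := y :- :1) refl y) (y#ℕ 1 2≤n))

    harmonic-identity :
      ∑[ i ≤ n ] (let k = toℕ i in let k≤n = toℕ≤pred[n] i in
        term k k≤n * H 2 k x (λ j 1≤j j≤k → x# j 1≤j (≤-trans j≤k k≤n)))
      ≈ ((- 1#) ^ n * A / (ν * (ν - 1#) * D) ⟨ *-#0 (n[n-1]#0 n 2≤n) D#0 ⟩)
        * (binom (x - y + ν) n / (binom (x + ν) n * binom y n)
             ⟨ *-#0 (binom[x+n]#0 n x x#) (binom[y]#0 n y y#) ⟩)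
        * (H 1 n x x# - H 1 n (x - y) x-y# + (ν * y / (D * A) ⟨ *-#0 D#0 1+x-y+ny#0 ⟩))
    harmonic-identity = *-cancelʳ N*Y#0 (begin
      _ * (N * Y)
        ≈⟨ *-congʳ left-sum ⟩
      Σ * (N * Y)
        ≈⟨ *-comm Σ (N * Y) ⟩
      N * Y * Σ
        ≈⟨ harmonic-sum x w v w⁻¹ v⁻¹ ⟩
      scale * (product n (λ i → (x + root i) * w i) * L)
        ≈⟨ *-congˡ (*-congʳ product-root) ⟩
      σ * (M * (y * (y - 1#))) * (A * z 0 * Z * W * L)
        ≈⟨ solve 7 (λ s M y a Z W L → s :* (M :* y) :* (a :* Z :* W :* L)
             := s :* a :* (M :* Z :* W) :* y :* L) refl σ M (y * (y - 1#)) (A * z 0) Z W L ⟩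
      σ * (A * z 0) * (M * Z * W) * (y * (y - 1#)) * L
        -- The factor `N * Y` to be cancelled is assembled from three sources: `prefactor` yields n
        -- (n - 1), `binomials` yields `Y`, and y (y - 1) is already present in `scale`.
        ≈⟨ *-cong (*-congʳ (*-cong (*-congˡ prefactor) (binomials _))) harmonic-difference ⟨
      σ * (A * a * (ν * (ν - 1#))) * (B * Y) * (y * (y - 1#)) * E
        ≈⟨ solve 8 (λ s A a n B Y y E → s :* (A :* a :* n) :* (B :* Y) :* y :* E
             := s :* A :* a :* B :* E :* (n :* y :* Y))
                 refl σ A a (ν * (ν - 1#)) B Y (y * (y - 1#)) E ⟩
      σ * A * a * B * E * (N * Y) ∎)
      where
      N = ν * (ν - 1#) * (y * (y - 1#))
      N*Y#0 : N * Y # 0#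
      N*Y#0 = *-#0 (*-#0 (n[n-1]#0 n 2≤n) y[y-1]#0)
        (falling#0 y n λ i i<n → y# (ℤ.+ i) (ℤ.neg-≤-pos {n} {i}) (ℤ.+<+ i<n))
      Σ = sum (suc n) (λ k → t k * sum k (λ j → w j * w j))
      L = sum n (λ i → w i - v i)
      σ = (- 1#) ^ n
      M = fromℕ (n !)
      a = recip (*-#0 (n[n-1]#0 n 2≤n) D#0)
      B = binom (x - y + ν) n / (binom (x + ν) n * binom y n)
            ⟨ *-#0 (binom[x+n]#0 n x x#) (binom[y]#0 n y y#) ⟩
      E = H 1 n x x# - H 1 n (x - y) x-y# + (ν * y / (D * A) ⟨ *-#0 D#0 1+x-y+ny#0 ⟩)

-- Specialization to the complex numbers

open import Defs

theorem14 :
  (n : ℕ) (2≤n : 2 ℕ.≤ n) (x y : ℂ) →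
  (x# : ∀ k → 1 ℕ.≤ k → k ℕ.≤ n → x # - fromℕ k) →
  (x-y# : ∀ k → 1 ℕ.≤ k → k ℕ.≤ n → x - y # - fromℕ k) →
  (1+x-y+ny#0 : 1# + x - y + fromℕ n * y # 0#) →
  (y# : ∀ j → ℤ.- (ℤ.+ n) ℤ.≤ j → j ℤ.< ℤ.+ n → y # fromℤ j) →
  ∑[ i ≤ n ] (let k = toℕ i in let k≤n = toℕ≤pred[n] i in
    (- 1#) ^ k * binom (fromℕ n) k
      * (binom (y + fromℕ k) k / binom (y - fromℕ n + fromℕ k) k ⟨ binom[y-n+k]#0 n y y# k k≤n ⟩)
      * ((y - 1#) * y / ((y + fromℕ k - 1#) * (y + fromℕ k)) ⟨ [y+k-1][y+k]#0 n y y# 2≤n k k≤n ⟩)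
      * H 2 k x (λ j 1≤j j≤k → x# j 1≤j (≤-trans j≤k k≤n)))
  ≈ ((- 1#) ^ n * (1# + x - y + fromℕ n * y)
       / (fromℕ n * (fromℕ n - 1#) * (1# + x - y))
       ⟨ *-#0 (n[n-1]#0 n 2≤n) (1+x-y#0 n 2≤n x y x-y#) ⟩)
    * (binom (x - y + fromℕ n) n
       / (binom (x + fromℕ n) n * binom y n)
       ⟨ *-#0 (binom[x+n]#0 n x x#) (binom[y]#0 n y y#) ⟩)
    * (H 1 n x x# - H 1 n (x - y) x-y#
       + (fromℕ n * y
          / ((1# + x - y) * (1# + x - y + fromℕ n * y))
          ⟨ *-#0 (1+x-y#0 n 2≤n x y x-y#) 1+x-y+ny#0 ⟩))
theorem14 (suc m) 2≤n x y x# x-y# 1+x-y+ny#0 y# =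
  HarmonicIdentity.harmonic-identity ℂ-heytingField ℂ-characteristicZero m 2≤n x y x# x-y# 1+x-y+ny#0 y#
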